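{- $\mathsf{SPT}^2_2 \not\le_{\rm sc} \mathsf{SIPT}^2_2$. That is, there is a stable 2-coloring of pairs $f$ such that for every stable 2-coloring of pairs $\widehat{f}$ computable from $f$ there is a set $\widehat{H}$ which is increasing p-homogeneous for $\widehat{f}$ and which computes no set p-homogeneous for $f$.
   Context: A 2-coloring of pairs is a function $f:[\omega]^2\to 2$; write $f(x,y)$ for $f(\{x,y\})$ with $x<y$. It is stable if $\lim_u f(x,u)$ exists for every $x$. A set $H=H_L\oplus H_R$ (with $H_L,H_R$ infinite) is p-homogeneous for $f$ if $f$ is constant on $\{\{x,y\}:x\in H_L,y\in H_R,x\ne y\}$, and increasing p-homogeneous for $f$ if $f$ is constant on $\{\{x,y\}: x<y, x\in H_L, y\in H_R\}$. $\mathsf{SPT}^2_2$ (resp. $\mathsf{SIPT}^2_2$) is the problem whose instances are stable 2-colorings of pairs and whose solutions are p-homogeneous (resp. increasing p-homogeneous) sets. $\mathsf P\le_{\rm sc}\mathsf Q$ means: every instance $X$ of $\mathsf P$ computes an instance $\widehat X$ of $\mathsf Q$ such that every solution of $\widehat X$ computes a solution of $X$. -}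

module Defs where

open import Data.Nat using (ℕ; zero; suc; _<_; _≤_; _<ᵇ_)
open import Data.Fin using (Fin)
open import Data.Bool using (Bool; true; false; if_then_else_)
open import Data.Vec using (Vec; []; _∷_; lookup)
open import Data.Product using (Σ; ∃; _×_; _,_; proj₁; proj₂)
open import Relation.Binary.PropositionalEquality using (_≡_; _≢_)
open import Relation.Nullary using (¬_)

Subset : Set
Subset = ℕ → Bool

Infinite : Subset → Set
Infinite A = ∀ n → ∃ λ m → n ≤ m × A m ≡ true

-- Effective join A ⊕ B = {2n : n ∈ A} ∪ {2n+1 : n ∈ B}.
_⊕_ : Subset → Subset → Subset
(A ⊕ B) zero = A 0
(A ⊕ B) (suc zero) = B 0
(A ⊕ B) (suc (suc n)) = ((λ k → A (suc k)) ⊕ (λ k → B (suc k))) n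

data PR : ℕ → Set where
  zer  : ∀ {n} → PR n
  succ : PR 1
  proj : ∀ {n} → Fin n → PR n
  orc  : PR 1
  comp : ∀ {m n} → PR m → Vec (PR n) m → PR n
  prec : ∀ {n} → PR n → PR (suc (suc n)) → PR (suc n)
  mu   : ∀ {n} → PR (suc n) → PR n

bit : Bool → ℕ
bit true = 1
bit false = 0

mutual
  data Eval (O : Subset) : ∀ {n} → PR n → Vec ℕ n → ℕ → Set where
    e-zer  : ∀ {n} {xs : Vec ℕ n} → Eval O zer xs 0
    e-succ : ∀ {x} → Eval O succ (x ∷ []) (suc x)
    e-proj : ∀ {n} {i : Fin n} {xs} → Eval O (proj i) xs (lookup xs i)
    e-orc  : ∀ {x} → Eval O orc (x ∷ []) (bit (O x))
    e-comp : ∀ {m n} {f : PR m} {gs : Vec (PR n) m} {xs ys y} →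
             EvalAll O gs xs ys → Eval O f ys y → Eval O (comp f gs) xs y
    e-prec0 : ∀ {n} {g : PR n} {h} {xs y} →
              Eval O g xs y → Eval O (prec g h) (0 ∷ xs) y
    e-precS : ∀ {n} {g : PR n} {h} {k xs r y} →
              Eval O (prec g h) (k ∷ xs) r → Eval O h (k ∷ r ∷ xs) y →
              Eval O (prec g h) (suc k ∷ xs) y
    e-mu   : ∀ {n} {f : PR (suc n)} {xs y} →
             Eval O f (y ∷ xs) 0 →
             (∀ z → z < y → ∃ λ k → Eval O f (z ∷ xs) (suc k)) →
             Eval O (mu f) xs y

  data EvalAll (O : Subset) {n : ℕ} : ∀ {m} → Vec (PR n) m → Vec ℕ n → Vec ℕ m → Set where
    ea-[] : ∀ {xs} → EvalAll O [] xs []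
    ea-∷  : ∀ {m} {g : PR n} {gs : Vec (PR n) m} {xs y ys} →
            Eval O g xs y → EvalAll O gs xs ys → EvalAll O (g ∷ gs) xs (y ∷ ys)

_≤T_ : Subset → Subset → Set
A ≤T B = ∃ λ (c : PR 1) → ∀ n → Eval B c (n ∷ []) (bit (A n))

-- 2-colorings of pairs.  f x y is the colour of {x,y} for x < y;
-- values with x ≥ y are irrelevant.

Coloring : Set
Coloring = ℕ → ℕ → Bool

col : Coloring → ℕ → ℕ → Bool
col f x y = if x <ᵇ y then f x y else f y x

-- Computable bijection ℕ → ℕ × ℕ enumerating diagonals.
unpair : ℕ → ℕ × ℕ
unpair zero = 0 , 0
unpair (suc n) with unpair n
... | zero , y = suc y , 0
... | suc x , y = x , suc y

-- The coloring as a subset of ω (canonical: junk entries set to false).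
enc : Coloring → Subset
enc f n = let p = unpair n in
  if proj₁ p <ᵇ proj₂ p then f (proj₁ p) (proj₂ p) else false

Stable : Coloring → Set
Stable f = ∀ x → ∃ λ (c : Bool) → ∃ λ N → ∀ u → N < u → x < u → f x u ≡ c

-- H = L ⊕ R is p-homogeneous for f
PHom : Coloring → Subset → Subset → Set
PHom f L R = Infinite L × Infinite R ×
  (∃ λ (c : Bool) → ∀ x y → L x ≡ true → R y ≡ true → x ≢ y → col f x y ≡ c)

-- H = L ⊕ R is increasing p-homogeneous for f
IncPHom : Coloring → Subset → Subset → Set
IncPHom f L R = Infinite L × Infinite R ×
  (∃ λ (c : Bool) → ∀ x y → x < y → L x ≡ true → R y ≡ true → f x y ≡ c)

{-# OPTIONS --safe #-}
-- Forcing with finite lists of convergent rows.  The adversary f̂ assigns every number d a limit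
-- colour, which is decided by finitely many rows of f.  For a pair of functionals Γ₀, Γ₁ (one for each
-- colour of f̂) suppose that neither can be defeated.  Build numbers ρ₀ < d₀ < ρ₁ < d₁ < … and
-- approximations g₀, g₁, … of f: at stage j every row below a bound m_j is given the limit 1, but equals
-- 0 on the interval between the last region fixed and m_j; then wait until f̂, computed from g_j,
-- settles at all dᵢ with i < j, and choose ρ_j after that.  Ramsey's theorem applied to the colour of dᵢ
-- at stage j yields an infinite set K of indices on which the dᵢ may serve as L, and the ρⱼ as R, in the
-- same colour c at all stages.  If Γ_c can be made to promise large elements by adding elements to R
-- only, it promises an element w whose row is still free; w gets the limit 0, contradicting the next
-- element, with limit 1.  Otherwise the bounds m_j can be chosen so that Γ_c outputs nothing in
-- [m_j , ρ_j]; then all its outputs lie where earlier rows are 0 although their limit is 1.  Either way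
-- the sets computed by Γ_c are not p-homogeneous for a suitable extension of some g_j.
module Submission where

open import Defs
open import Axiom.ExcludedMiddle using (ExcludedMiddle)
open import Level using (0ℓ)
open import Data.Product using (Σ; _×_)
open import Relation.Nullary using (¬_)
open import Data.Bool using (Bool; true; false; not; T; if_then_else_)
import Data.Bool.Properties as Bool
open import Data.Empty using (⊥; ⊥-elim)
open import Data.List using (List; []; _∷_; _++_; map; concatMap; upTo; allFin;
  cartesianProduct; cartesianProductWith)
open import Data.List.Membership.Propositional using (_∈_; lose)
open import Data.List.Membership.Propositional.Properties
open import Data.List.Relation.Unary.Any using (here; there)
open import Data.Nat hiding (compare)
open import Data.Nat.Properties
open import Data.Product using (∃; _,_; proj₁; proj₂)
open import Data.Sum using (_⊎_; inj₁; inj₂; map₂)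
open import Data.Unit using (tt)
open import Data.Vec using (Vec; []; _∷_)
open import Relation.Binary.Definitions using (Tri; tri<; tri≈; tri>)
open import Relation.Binary.PropositionalEquality
open import Relation.Nullary using (Dec; yes; no; does)

-- Oracle computations: determinism and use

-- What separates the two problems is that p-homogeneity compares a pair in both orders: the row of
-- every element of a solution, on either side, must have the colour of the solution as its limit.
-- Increasing p-homogeneity asks this of L alone. So R is cheap to build: once the elements of L are
-- locked to a colour, any later number may enter R under the same condition. This is why the
-- promises are sought among extensions of R only. The obstacle is that limits must not be settled
-- early: a row that is 1 from some point on cannot be 0 on later intervals. Hence the condition of
-- a stage is abandoned and only finitely many of its pairs are kept. Its locks are lost, but the
-- computed colours of the pairs of `dᵢ` and `ρⱼ` persist, having finite use. Each stage locks the
-- `dᵢ` anew, possibly in another colour; Ramsey's theorem repairs this. As that theorem chooses the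
-- colour, only one of two goals, one for each colour, can be guaranteed. Treating all pairs of
-- goals still leaves one colour in which every goal is reached. Adversaries that fail to be total
-- or stable are excluded by genericity.

suc≢0 : ∀ {k : ℕ} → 0 ≡ suc k → ⊥
suc≢0 ()

mutual
  Eval-deterministic : ∀ {O n} {p : PR n} {xs y z} → Eval O p xs y → Eval O p xs z → y ≡ z
  Eval-deterministic e-zer e-zer = refl
  Eval-deterministic e-succ e-succ = refl
  Eval-deterministic e-proj e-proj = refl
  Eval-deterministic e-orc e-orc = refl
  Eval-deterministic (e-comp as e) (e-comp as′ e′) with EvalAll-deterministic as as′
  ... | refl = Eval-deterministic e e′
  Eval-deterministic (e-prec0 e) (e-prec0 e′) = Eval-deterministic e e′
  Eval-deterministic (e-precS r e) (e-precS r′ e′) with Eval-deterministic r r′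
  ... | refl = Eval-deterministic e e′
  Eval-deterministic (e-mu {y = y} e below) (e-mu {y = z} e′ below′) with <-cmp y z
  ... | tri< y<z _ _ = ⊥-elim (suc≢0 (Eval-deterministic e (proj₂ (below′ y y<z))))
  ... | tri≈ _ y≡z _ = y≡z
  ... | tri> _ _ z<y = ⊥-elim (suc≢0 (sym (Eval-deterministic (proj₂ (below z z<y)) e′)))

  EvalAll-deterministic : ∀ {O n m} {ps : Vec (PR n) m} {xs ys zs} →
                          EvalAll O ps xs ys → EvalAll O ps xs zs → ys ≡ zs
  EvalAll-deterministic ea-[] ea-[] = refl
  EvalAll-deterministic (ea-∷ e es) (ea-∷ e′ es′) =
    cong₂ _∷_ (Eval-deterministic e e′) (EvalAll-deterministic es es′)

AgreeBelow : ℕ → Subset → Subset → Set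
AgreeBelow k O O′ = ∀ n → n < k → O′ n ≡ O n

agree-≤ : ∀ {j k O O′} → j ≤ k → AgreeBelow k O O′ → AgreeBelow j O O′
agree-≤ j≤k a n n<j = a n (<-≤-trans n<j j≤k)

-- A search `mu` runs one computation for every `z < y`, each with its own use; monotonicity lets
-- one number serve all of them.
bounded-choice : (P : ℕ → ℕ → Set) → (∀ {z j k} → j ≤ k → P z j → P z k) →
                 ∀ y → (∀ z → z < y → ∃ (P z)) → ∃ λ k → ∀ z → z < y → P z k
bounded-choice P mono zero b = 0 , λ _ ()
bounded-choice P mono (suc y) b
  with bounded-choice P mono y (λ z z<y → b z (m<n⇒m<1+n z<y)) | b y (n<1+n y)
... | k , pk | j , pj = k ⊔ j , λ z z<1+y → go z (m≤n⇒m<n∨m≡n (≤-pred z<1+y))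
  where
  go : ∀ z → z < y ⊎ z ≡ y → P z (k ⊔ j)
  go z (inj₁ z<y) = mono (m≤m⊔n k j) (pk z z<y)
  go z (inj₂ refl) = mono (m≤n⊔m k j) pj

mutual
  use : ∀ {O n} {p : PR n} {xs y} → Eval O p xs y →
        ∃ λ k → ∀ O′ → AgreeBelow k O O′ → Eval O′ p xs y
  use e-zer = 0 , λ _ _ → e-zer
  use e-succ = 0 , λ _ _ → e-succ
  use e-proj = 0 , λ _ _ → e-proj
  use {O} (e-orc {x}) = suc x , λ O′ a →
    subst (λ b → Eval O′ orc (x ∷ []) (bit b)) (a x (n<1+n x)) e-orc
  use (e-comp as e) with useAll as | use e
  ... | j , f | k , g = j ⊔ k , λ O′ a →
    e-comp (f O′ (agree-≤ (m≤m⊔n j k) a)) (g O′ (agree-≤ (m≤n⊔m j k) a))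
  use (e-prec0 e) with use e
  ... | k , g = k , λ O′ a → e-prec0 (g O′ a)
  use (e-precS r e) with use r | use e
  ... | j , f | k , g = j ⊔ k , λ O′ a →
    e-precS (f O′ (agree-≤ (m≤m⊔n j k) a)) (g O′ (agree-≤ (m≤n⊔m j k) a))
  use {O} (e-mu {f = f} {xs} {y} e below)
    with use e
       | bounded-choice
           (λ z k → ∀ O′ → AgreeBelow k O O′ → ∃ λ v → Eval O′ f (z ∷ xs) (suc v))
           (λ j≤k h O′ a → h O′ (agree-≤ j≤k a)) y
           (λ z z<y → proj₁ (use (proj₂ (below z z<y))) ,
                      λ O′ a → proj₁ (below z z<y) , proj₂ (use (proj₂ (below z z<y))) O′ a)
  ... | j , g | k , h = j ⊔ k , λ O′ a →
    e-mu (g O′ (agree-≤ (m≤m⊔n j k) a)) (λ z z<y → h z z<y O′ (agree-≤ (m≤n⊔m j k) a))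

  useAll : ∀ {O n m} {ps : Vec (PR n) m} {xs ys} → EvalAll O ps xs ys →
           ∃ λ k → ∀ O′ → AgreeBelow k O O′ → EvalAll O′ ps xs ys
  useAll ea-[] = 0 , λ _ _ → ea-[]
  useAll (ea-∷ e es) with use e | useAll es
  ... | j , f | k , g = j ⊔ k , λ O′ a →
    ea-∷ (f O′ (agree-≤ (m≤m⊔n j k) a)) (g O′ (agree-≤ (m≤n⊔m j k) a))

-- Codings and enumerations

unpair-≤ : ∀ n → proj₁ (unpair n) ≤ n × proj₂ (unpair n) ≤ n
unpair-≤ zero = z≤n , z≤n
unpair-≤ (suc n) with unpair n | unpair-≤ n
... | zero , y | _ , y≤n = s≤s y≤n , z≤n
... | suc x , y | 1+x≤n , y≤n = m≤n⇒m≤1+n (≤-trans (n≤1+n x) 1+x≤n) , s≤s y≤n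

unpair-step : ∀ n {x y} → unpair n ≡ (suc x , y) → unpair (suc n) ≡ (x , suc y)
unpair-step n eq with unpair n
unpair-step n refl | _ = refl

unpair-turn : ∀ n {y} → unpair n ≡ (0 , y) → unpair (suc n) ≡ (suc y , 0)
unpair-turn n eq with unpair n
unpair-turn n refl | _ = refl

abstract
  -- The diagonal with sum `s` is entered at `(s , 0)`, right after `(0 , s - 1)`, and is then
  -- traversed by increasing the second component.
  unpair-diagonal : ∀ x y → ∃ λ n → unpair n ≡ (x , y)
  unpair-diagonal x y = subst (λ s → ∃ λ n → unpair n ≡ (s , y)) (m+n∸n≡m x y)
                          (go (x + y) y (m≤n+m y x))
    where
    go : ∀ s y → y ≤ s → ∃ λ n → unpair n ≡ (s ∸ y , y)
    go zero zero _ = 0 , refl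
    go (suc s) zero _ with go s s ≤-refl
    ... | n , eq = suc n , unpair-turn n (trans eq (cong (_, s) (n∸n≡0 s)))
    go s (suc y) y<s with go s y (<⇒≤ y<s)
    ... | n , eq = suc n , unpair-step n (trans eq (cong (_, y) (sym (suc-∸ y<s))))
      where
      suc-∸ : ∀ {y s} → y < s → suc (s ∸ suc y) ≡ s ∸ y
      suc-∸ {y} {suc s} (s≤s y≤s) = sym (+-∸-assoc 1 y≤s)

pair : ℕ → ℕ → ℕ
pair x y = proj₁ (unpair-diagonal x y)

AgreePairs : ℕ → Coloring → Coloring → Set
AgreePairs k f f′ = ∀ x y → x < y → y < k → f′ x y ≡ f x y

<ᵇ-true : ∀ {m n} → m < n → (m <ᵇ n) ≡ true
<ᵇ-true {m} {n} m<n with m <ᵇ n | <⇒<ᵇ m<n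
... | true | _ = refl

<ᵇ-false : ∀ {m n} → n ≤ m → (m <ᵇ n) ≡ false
<ᵇ-false {m} {n} n≤m with m <ᵇ n in eq
... | false = refl
... | true = ⊥-elim (<⇒≱ (<ᵇ⇒< m n (subst T (sym eq) tt)) n≤m)

enc-pair : ∀ f {x y} → x < y → enc f (pair x y) ≡ f x y
enc-pair f {x} {y} x<y rewrite proj₂ (unpair-diagonal x y) | <ᵇ-true x<y = refl

-- Both components of `unpair n` are at most `n`, so the same `k` bounds the oracle questions and
-- the pairs behind them.
enc-agree : ∀ {k f f′} → AgreePairs k f f′ → AgreeBelow k (enc f) (enc f′)
enc-agree a n n<k with proj₁ (unpair n) <ᵇ proj₂ (unpair n) in eq
... | false = refl
... | true = a _ _ (<ᵇ⇒< _ _ (subst T (sym eq) tt)) (≤-<-trans (proj₂ (unpair-≤ n)) n<k)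

double : ℕ → ℕ
double zero = zero
double (suc n) = suc (suc (double n))

join-even : ∀ A B n → (A ⊕ B) (double n) ≡ A n
join-even A B zero = refl
join-even A B (suc n) = join-even (λ k → A (suc k)) (λ k → B (suc k)) n

join-odd : ∀ A B n → (A ⊕ B) (suc (double n)) ≡ B n
join-odd A B zero = refl
join-odd A B (suc n) = join-odd (λ k → A (suc k)) (λ k → B (suc k)) n

join-agree : ∀ {A A′ B B′} k → AgreeBelow k A A′ → AgreeBelow k B B′ →
             AgreeBelow k (A ⊕ B) (A′ ⊕ B′)
join-agree k a b zero 0<k = a 0 0<k
join-agree k a b (suc zero) 1<k = b 0 (<-trans (n<1+n 0) 1<k)
join-agree (suc (suc k)) a b (suc (suc n)) (s≤s (s≤s n<k)) =
  join-agree (suc k) (λ x p → a (suc x) (s≤s p)) (λ x p → b (suc x) (s≤s p)) n (m<n⇒m<1+n n<k)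

-- Increasing finite levels replace a sequence: products and sums are formed level by level, and
-- round `n` of the construction treats a whole level.
record Enumeration (A : Set) : Set where
  field
    level : ℕ → List A
    grows : ∀ {m n a} → m ≤ n → a ∈ level m → a ∈ level n
    covers : ∀ a → ∃ λ n → a ∈ level n

open Enumeration

ℕ-enumeration : Enumeration ℕ
ℕ-enumeration .level = upTo
ℕ-enumeration .grows m≤n a∈ = ∈-upTo⁺ (<-≤-trans (∈-upTo⁻ a∈) m≤n)
ℕ-enumeration .covers n = suc n , ∈-upTo⁺ (n<1+n n)

Bool-enumeration : Enumeration Bool
Bool-enumeration .level _ = true ∷ false ∷ []
Bool-enumeration .grows _ a∈ = a∈
Bool-enumeration .covers true = 0 , here refl
Bool-enumeration .covers false = 0 , there (here refl)

_×-enumeration_ : ∀ {A B} → Enumeration A → Enumeration B → Enumeration (A × B)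
(EA ×-enumeration EB) .level n = cartesianProduct (level EA n) (level EB n)
(EA ×-enumeration EB) .grows {m} m≤n ab∈ with ∈-cartesianProduct⁻ (level EA m) (level EB m) ab∈
... | a∈ , b∈ = ∈-cartesianProduct⁺ (grows EA m≤n a∈) (grows EB m≤n b∈)
(EA ×-enumeration EB) .covers (a , b) with covers EA a | covers EB b
... | m , a∈ | n , b∈ = m ⊔ n ,
  ∈-cartesianProduct⁺ (grows EA (m≤m⊔n m n) a∈) (grows EB (m≤n⊔m m n) b∈)

_⊎-enumeration_ : ∀ {A B} → Enumeration A → Enumeration B → Enumeration (A ⊎ B)
(EA ⊎-enumeration EB) .level n = map inj₁ (level EA n) ++ map inj₂ (level EB n)
(EA ⊎-enumeration EB) .grows {m} {n} m≤n c∈ with ∈-++⁻ (map inj₁ (level EA m)) c∈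
... | inj₁ p with ∈-map⁻ inj₁ p
...   | a , a∈ , refl = ∈-++⁺ˡ (∈-map⁺ inj₁ (grows EA m≤n a∈))
(EA ⊎-enumeration EB) .grows {m} {n} m≤n c∈ | inj₂ p with ∈-map⁻ inj₂ p
...   | b , b∈ , refl = ∈-++⁺ʳ (map inj₁ (level EA n)) (∈-map⁺ inj₂ (grows EB m≤n b∈))
(EA ⊎-enumeration EB) .covers (inj₁ a) with covers EA a
... | n , a∈ = n , ∈-++⁺ˡ (∈-map⁺ inj₁ a∈)
(EA ⊎-enumeration EB) .covers (inj₂ b) with covers EB b
... | n , b∈ = n , ∈-++⁺ʳ (map inj₁ (level EA n)) (∈-map⁺ inj₂ b∈)

vectors : {A : Set} → List A → ∀ m → List (Vec A m)
vectors xs zero = [] ∷ []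
vectors xs (suc m) = cartesianProductWith _∷_ xs (vectors xs m)

codes : ℕ → ∀ n → List (PR n)
newCodes : ℕ → ∀ n → List (PR n)
-- `succ`, `orc` and `prec` constrain the arity and are split off here, so that `newCodes` treats
-- the other constructors uniformly in `n`.
arityCodes : ℕ → ∀ n → List (PR n)

codes zero n = []
codes (suc k) n = newCodes k n ++ codes k n

newCodes k n = zer ∷ map proj (allFin n) ++ map mu (codes k (suc n)) ++
  concatMap (λ m → cartesianProductWith comp (codes k m) (vectors (codes k n) m)) (upTo k) ++
  arityCodes k n

arityCodes k zero = []
arityCodes k (suc zero) = succ ∷ orc ∷ cartesianProductWith prec (codes k 0) (codes k 2)
arityCodes k (suc (suc n)) = cartesianProductWith prec (codes k (suc n)) (codes k (suc (suc (suc n))))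

codes-grow : ∀ {j k n} {p : PR n} → j ≤ k → p ∈ codes j n → p ∈ codes k n
codes-grow j≤k p∈ = go (≤⇒≤′ j≤k) p∈
  where
  go : ∀ {j k n} {p : PR n} → j ≤′ k → p ∈ codes j n → p ∈ codes k n
  go ≤′-refl p∈ = p∈
  go {k = suc k} {n} (≤′-step j≤′k) p∈ = ∈-++⁺ʳ (newCodes k n) (go j≤′k p∈)

vectors-grow : ∀ {j k n m} {v : Vec (PR n) m} → j ≤ k →
               v ∈ vectors (codes j n) m → v ∈ vectors (codes k n) m
vectors-grow {m = zero} j≤k v∈ = v∈
vectors-grow {j} {n = n} {m = suc m} j≤k v∈
  with ∈-cartesianProductWith⁻ _∷_ (codes j n) (vectors (codes j n) m) v∈
... | p , v , p∈ , v∈′ , refl =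
  ∈-cartesianProductWith⁺ _∷_ (codes-grow j≤k p∈) (vectors-grow j≤k v∈′)

prec∈arityCodes : ∀ {k n} {g : PR n} {h} → g ∈ codes k n → h ∈ codes k (suc (suc n)) →
                  prec g h ∈ arityCodes k (suc n)
prec∈arityCodes {n = zero} g∈ h∈ = there (there (∈-cartesianProductWith⁺ prec g∈ h∈))
prec∈arityCodes {n = suc n} g∈ h∈ = ∈-cartesianProductWith⁺ prec g∈ h∈

arity⇒codes : ∀ {k n} {p : PR n} → p ∈ arityCodes k n → p ∈ codes (suc k) n
arity⇒codes {k} {n} p∈ = ∈-++⁺ˡ {ys = codes k n} (there (∈-++⁺ʳ (map proj (allFin n))
  (∈-++⁺ʳ (map mu (codes k (suc n))) (∈-++⁺ʳ (concatMap _ (upTo k)) p∈))))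

mutual
  codes-cover : ∀ {n} (p : PR n) → ∃ λ k → p ∈ codes k n
  codes-cover zer = 1 , here refl
  codes-cover succ = 1 , arity⇒codes {0} (here refl)
  codes-cover (proj i) = 1 , there (∈-++⁺ˡ (∈-++⁺ˡ (∈-map⁺ proj (∈-allFin i))))
  codes-cover orc = 1 , arity⇒codes {0} (there (here refl))
  codes-cover {n} (comp {m} f gs) with codes-cover f | vectors-cover gs
  ... | i , f∈ | j , gs∈ = suc k , ∈-++⁺ˡ {ys = codes k n} (there
      (∈-++⁺ʳ (map proj (allFin n)) (∈-++⁺ʳ (map mu (codes k (suc n)))
      (∈-++⁺ˡ {ys = arityCodes k n} (∈-concatMap⁺ _ (lose (∈-upTo⁺ {n = k} {m} (m≤n⊔m (i ⊔ j) (suc m)))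
        (∈-cartesianProductWith⁺ comp
          (codes-grow (≤-trans (m≤m⊔n i j) (m≤m⊔n (i ⊔ j) (suc m))) f∈)
          (vectors-grow (≤-trans (m≤n⊔m i j) (m≤m⊔n (i ⊔ j) (suc m))) gs∈))))))))
    where
    -- The term `suc m` is there because `newCodes k` composes only with functions of arity below
    -- `k`.
    k = (i ⊔ j) ⊔ suc m
  codes-cover (prec g h) with codes-cover g | codes-cover h
  ... | i , g∈ | j , h∈ = suc (i ⊔ j) , arity⇒codes {i ⊔ j}
    (prec∈arityCodes {i ⊔ j} (codes-grow (m≤m⊔n i j) g∈) (codes-grow (m≤n⊔m i j) h∈))
  codes-cover {n} (mu f) with codes-cover f
  ... | k , f∈ = suc k , ∈-++⁺ˡ {ys = codes k n} (there
    (∈-++⁺ʳ (map proj (allFin n)) (∈-++⁺ˡ (∈-map⁺ mu f∈))))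

  vectors-cover : ∀ {n m} (v : Vec (PR n) m) → ∃ λ k → v ∈ vectors (codes k n) m
  vectors-cover [] = 0 , here refl
  vectors-cover (p ∷ v) with codes-cover p | vectors-cover v
  ... | i , p∈ | j , v∈ = i ⊔ j , ∈-cartesianProductWith⁺ _∷_
    (codes-grow (m≤m⊔n i j) p∈) (vectors-grow (m≤n⊔m i j) v∈)

PR-enumeration : Enumeration (PR 1)
PR-enumeration .level k = codes k 1
PR-enumeration .grows = codes-grow
PR-enumeration .covers = codes-cover

-- Classical logic and Ramsey's theorem for pairs

iterate : {S : Set} {R : S → S → Set} → (∀ s → ∃ (R s)) → S → ℕ → S
iterate step s zero = s
iterate step s (suc n) = proj₁ (step (iterate step s n))

iterate-step : {S : Set} {R : S → S → Set} (step : ∀ s → ∃ (R s)) (s : S) →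
               ∀ n → R (iterate step s n) (iterate step s (suc n))
iterate-step step s n = proj₂ (step (iterate step s n))

transitive-chain : {S : Set} {_≼_ : S → S → Set} → (∀ {s} → s ≼ s) →
                   (∀ {r s t} → r ≼ s → s ≼ t → r ≼ t) → (f : ℕ → S) →
                   (∀ n → f (suc n) ≼ f n) → ∀ {m n} → m ≤ n → f n ≼ f m
transitive-chain {_≼_ = _≼_} rfl trs f step m≤n = go (≤⇒≤′ m≤n)
  where
  go : ∀ {m n} → m ≤′ n → f n ≼ f m
  go ≤′-refl = rfl
  go (≤′-step m≤′n) = trs (step _) (go m≤′n)

module Classical (em : ExcludedMiddle 0ℓ) where

  dne : {P : Set} → ¬ ¬ P → P
  dne {P} ¬¬p with em {P}
  ... | yes p = p
  ... | no ¬p = ⊥-elim (¬¬p ¬p)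

  ¬∀⇒∃¬ : {A : Set} {P : A → Set} → ¬ (∀ a → P a) → ∃ λ a → ¬ P a
  ¬∀⇒∃¬ ¬∀ = dne λ ¬∃ → ¬∀ λ a → dne λ ¬p → ¬∃ (a , ¬p)

  truth : Set → Bool
  truth P = does (em {P})

  truth-sound : {P : Set} → truth P ≡ true → P
  truth-sound {P} eq with em {P}
  ... | yes p = p

  truth-complete : {P : Set} → P → truth P ≡ true
  truth-complete {P} p with em {P}
  ... | yes _ = refl
  ... | no ¬p = ⊥-elim (¬p p)

  infinite-split : ∀ {A} → Infinite A → (p : ℕ → Bool) →
                   ∃ λ c → ∀ n → ∃ λ x → n ≤ x × A x ≡ true × p x ≡ c
  infinite-split {A} inf p with em {∀ n → ∃ λ x → n ≤ x × A x ≡ true × p x ≡ true}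
  ... | yes h = true , h
  ... | no ¬h with ¬∀⇒∃¬ ¬h
  ...   | k , none = false , below
    where
    below : ∀ n → ∃ λ x → n ≤ x × A x ≡ true × p x ≡ false
    below n with inf (k ⊔ n)
    ... | x , k⊔n≤x , x∈A with p x in px
    ...   | false = x , ≤-trans (m≤n⊔m k n) k⊔n≤x , x∈A , px
    ...   | true = ⊥-elim (none (x , ≤-trans (m≤m⊔n k n) k⊔n≤x , x∈A , px))

  module Ramsey (t : ℕ → ℕ → Bool) where

    Pool : Set
    Pool = Σ Subset Infinite

    -- A chosen member rather than the minimum; the order comes from `after`, which discards
    -- everything up to it.
    least : Pool → ℕ
    least (B , inf) = proj₁ (inf 0)

    record Refines (P P′ : Pool) : Set where
      field
        colour : Bool
        member : proj₁ P (least P) ≡ true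
        shrinks : ∀ x → proj₁ P′ x ≡ true → proj₁ P x ≡ true
        after : ∀ x → proj₁ P′ x ≡ true → least P < x
        constant : ∀ x → proj₁ P′ x ≡ true → t (least P) x ≡ colour

    open Refines

    refine : ∀ P → ∃ (Refines P)
    refine (B , inf) = let
        (a , _ , a∈B) = inf 0
        (c , many) = infinite-split inf (t a)
        Next = λ x → a < x × B x ≡ true × t a x ≡ c
      in ((λ x → truth (Next x)) ,
          λ n → let (x , n≤x , x∈B , tax) = many (n ⊔ suc a) in
                x , ≤-trans (m≤m⊔n n (suc a)) n≤x ,
                truth-complete (≤-trans (m≤n⊔m n (suc a)) n≤x , x∈B , tax)) ,
         record
           { colour = c
           ; member = a∈B
           ; shrinks = λ x x∈ → proj₁ (proj₂ (truth-sound {Next x} x∈))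
           ; after = λ x x∈ → proj₁ (truth-sound {Next x} x∈)
           ; constant = λ x x∈ → proj₂ (proj₂ (truth-sound {Next x} x∈))
           }

    pool : ℕ → Pool
    pool = iterate refine ((λ _ → true) , λ n → n , ≤-refl , refl)

    step : ∀ n → Refines (pool n) (pool (suc n))
    step = iterate-step refine ((λ _ → true) , λ n → n , ≤-refl , refl)

    elem : ℕ → ℕ
    elem n = least (pool n)

    pool-antitone : ∀ {m n} → m ≤ n → ∀ x → proj₁ (pool n) x ≡ true → proj₁ (pool m) x ≡ true
    pool-antitone = transitive-chain {_≼_ = λ P Q → ∀ x → proj₁ P x ≡ true → proj₁ Q x ≡ true}
      (λ _ p → p) (λ f g x p → g x (f x p)) pool (λ n → shrinks (step n))

    elem-later : ∀ {m n} → m < n → proj₁ (pool (suc m)) (elem n) ≡ true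
    elem-later {n = n} m<n = pool-antitone m<n _ (member (step n))

    elem-< : ∀ {m n} → m < n → elem m < elem n
    elem-< {m} m<n = after (step m) _ (elem-later m<n)

    elem-≥ : ∀ n → n ≤ elem n
    elem-≥ zero = z≤n
    elem-≥ (suc n) = ≤-<-trans (elem-≥ n) (elem-< (n<1+n n))

    -- The colour of two `elem`s depends only on the earlier one, so it suffices to keep infinitely
    -- many whose `colour` is the same.
    homogeneous : ∃ λ c → ∃ λ K → Infinite K ×
                  (∀ i j → i < j → K i ≡ true → K j ≡ true → t i j ≡ c)
    homogeneous with infinite-split {λ _ → true} (λ n → n , ≤-refl , refl) (λ n → colour (step n))
    ... | c , many = c , (λ x → truth (In x)) , inf , hom
      where
      In : ℕ → Set
      In x = ∃ λ n → elem n ≡ x × colour (step n) ≡ c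
      inf : Infinite (λ x → truth (In x))
      inf n with many n
      ... | k , n≤k , _ , ck = elem k , ≤-trans n≤k (elem-≥ k) , truth-complete (k , refl , ck)
      hom : ∀ i j → i < j → truth (In i) ≡ true → truth (In j) ≡ true → t i j ≡ c
      hom i j i<j i∈ j∈ with truth-sound {In i} i∈ | truth-sound {In j} j∈
      ... | a , refl , ca | b , refl , _ with a <? b
      ...   | yes a<b = trans (constant (step a) _ (elem-later a<b)) ca
      ...   | no a≮b with m≤n⇒m<n∨m≡n (≮⇒≥ a≮b)
      ...     | inj₁ b<a = ⊥-elim (<-asym i<j (elem-< b<a))
      ...     | inj₂ refl = ⊥-elim (<-irrefl refl i<j)

-- Conditions, stems and locking

Convergent : Subset → Set
Convergent r = ∃ λ (c : Bool) → ∃ λ N → ∀ u → N ≤ u → r u ≡ c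

-- Only the rows below `rows` bind an extension, but each of them is bound entirely and with its
-- limit; stability of the generic coloring follows from this.
record Condition : Set where
  field
    rows : ℕ
    coloring : Coloring
    convergent : ∀ x → Convergent (coloring x)
open Condition public

infix 4 _⊑_ _extends_
_extends_ : Coloring → Condition → Set
f extends q = ∀ x → x < rows q → ∀ y → f x y ≡ coloring q x y

record _⊑_ (q′ q : Condition) : Set where
  constructor _,_
  field
    more-rows : rows q ≤ rows q′
    same-rows : coloring q′ extends q
open _⊑_ public

⊑-refl : ∀ {q} → q ⊑ q
⊑-refl = ≤-refl , λ _ _ _ → refl

extends-⊑ : ∀ {f q q′} → q′ ⊑ q → f extends q′ → f extends q
extends-⊑ (n≤ , e) fe x x<n y = trans (fe x (<-≤-trans x<n n≤) y) (e x x<n y)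

⊑-trans : ∀ {q q′ q″} → q″ ⊑ q′ → q′ ⊑ q → q″ ⊑ q
⊑-trans (n≤ , e) q′⊑q = ≤-trans (more-rows q′⊑q) n≤ , extends-⊑ q′⊑q e

extends-self : ∀ q → coloring q extends q
extends-self q _ _ _ = refl

if-true : ∀ {A : Set} {b} {x y : A} → b ≡ true → (if b then x else y) ≡ x
if-true refl = refl

if-false : ∀ {A : Set} {b} {x y : A} → b ≡ false → (if b then x else y) ≡ y
if-false refl = refl

-- An extension `f` of `q` may have divergent rows. Cutting the new rows at column `k` gives a
-- condition that still fixes all pairs below `k`, which preserves any computation with use `k`.
truncate : Condition → Coloring → ℕ → Condition
truncate q f k = record
  { rows = rows q ⊔ k
  ; coloring = λ x y → if x <ᵇ rows q then coloring q x y else if y <ᵇ k then f x y else false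
  ; convergent = conv
  }
  where
  conv : ∀ x → Convergent
    (λ y → if x <ᵇ rows q then coloring q x y else if y <ᵇ k then f x y else false)
  conv x with x <ᵇ rows q
  ... | true = convergent q x
  ... | false = false , k , λ u k≤u → if-false (<ᵇ-false k≤u)

truncate-⊑ : ∀ q f k → truncate q f k ⊑ q
truncate-⊑ q f k = m≤m⊔n (rows q) k , λ x x<n y → if-true (<ᵇ-true x<n)

truncate-agree : ∀ q f k → f extends q → ∀ f′ → f′ extends truncate q f k → AgreePairs k f f′
truncate-agree q f k fq f′ f′q x y x<y y<k with x <? rows q
... | yes x<n = trans (f′q x (<-≤-trans x<n (m≤m⊔n (rows q) k)) y)
                (trans (if-true (<ᵇ-true x<n)) (sym (fq x x<n y)))
... | no x≮n = trans (f′q x (<-≤-trans (<-trans x<y y<k) (m≤n⊔m (rows q) k)) y)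
               (trans (if-false (<ᵇ-false (≮⇒≥ x≮n))) (if-true (<ᵇ-true y<k)))

-- Reservoirs and stems approximate a pair of sets: the tag false stands for L, true for R.
Reservoir : Set
Reservoir = Bool → Subset

AllInfinite : Reservoir → Set
AllInfinite A = ∀ τ → Infinite (A τ)

infix 4 _⊆_
_⊆_ : Reservoir → Reservoir → Set
A ⊆ B = ∀ τ x → A τ x ≡ true → B τ x ≡ true

⊆-trans : ∀ {A B C} → A ⊆ B → B ⊆ C → A ⊆ C
⊆-trans p q τ x a = q τ x (p τ x a)

-- Below `bound`, membership is decided both ways; values of `members` from `bound` on carry no
-- information.
record Stem : Set where
  constructor stem
  field
    members : Reservoir
    bound : ℕ
open Stem public

record Ext (A : Reservoir) (s s′ : Stem) : Set where
  constructor ext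
  field
    longer : bound s ≤ bound s′
    same : ∀ τ x → x < bound s → members s′ τ x ≡ members s τ x
    new : ∀ τ x → bound s ≤ x → x < bound s′ → members s′ τ x ≡ true → A τ x ≡ true
open Ext public

Ext-refl : ∀ {A s} → Ext A s s
Ext-refl = ext ≤-refl (λ _ _ _ → refl) (λ _ _ k≤x x<k → ⊥-elim (<⇒≱ x<k k≤x))

Ext-trans : ∀ {A s s′ s″} → Ext A s s′ → Ext A s′ s″ → Ext A s s″
Ext-trans {A} {s} {s′} {s″} e e′ = ext (≤-trans (longer e) (longer e′))
  (λ τ x x<k → trans (same e′ τ x (<-≤-trans x<k (longer e))) (same e τ x x<k)) nw
  where
  nw : ∀ τ x → bound s ≤ x → x < bound s″ → members s″ τ x ≡ true → A τ x ≡ true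
  nw τ x k≤x x<k″ x∈ with x <? bound s′
  ... | yes x<k′ = new e τ x k≤x x<k′ (trans (sym (same e′ τ x x<k′)) x∈)
  ... | no x≮k′ = new e′ τ x (≮⇒≥ x≮k′) x<k″ x∈

Ext-⊆ : ∀ {A B s s′} → A ⊆ B → Ext A s s′ → Ext B s s′
Ext-⊆ A⊆B e = ext (longer e) (same e) (λ τ x p q r → A⊆B τ x (new e τ x p q r))

-- A functional is given by the relation "on oracle L ⊕ R, the element x is put into the set with tag τ".
Functional : Set₁
Functional = Reservoir → Bool → ℕ → Set

Out : Functional → Stem → Bool → ℕ → Set
Out γ s τ x = ∀ A → (∀ σ y → y < bound s → A σ y ≡ members s σ y) → γ A τ x

Out-Ext : ∀ {γ A s s′ τ x} → Ext A s s′ → Out γ s τ x → Out γ s′ τ x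
Out-Ext e o B agree = o B (λ σ y y<k → trans (agree σ y (<-≤-trans y<k (longer e))) (same e σ y y<k))

PairOut : Functional → Stem → ℕ → Set
PairOut γ s b = ∃ λ x → ∃ λ y → x ≢ y × b ≤ x × b ≤ y × Out γ s false x × Out γ s true y

-- From an oracle that extends `s` inside `A`, such a functional cannot compute two infinite sets:
-- they would contain two distinct elements beyond `b`, and a finite part of the oracle would
-- already output them.
Dead : Functional → Stem → Reservoir → ℕ → Set
Dead γ s A b = ∀ s′ → Ext A s s′ → ¬ PairOut γ s′ b

Bad : Functional → Condition → Stem → Set
Bad γ q s = ∀ f → f extends q → ∀ (P : Reservoir) → (∀ τ x → Out γ s τ x → P τ x ≡ true) →
            ¬ PHom f (P false) (P true)

-- This is the formal promise: no passage to thinner infinite sets can prevent the output. Its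
-- failure yields, by `deny`, a thinning that prevents it for good.
Undeniable : Functional → Stem → Reservoir → Bool → ℕ → Set
Undeniable γ s A τ w = ∀ A′ → A′ ⊆ A → AllInfinite A′ → ∃ λ s′ → Ext A′ s s′ × Out γ s′ τ w

record ROnly (A : Reservoir) (s s′ : Stem) : Set where
  constructor r-only
  field
    extension : Ext A s s′
    none : ∀ x → bound s ≤ x → x < bound s′ → members s′ false x ≡ false
open ROnly public

abstract
  put : Reservoir → Bool → ℕ → Bool → Reservoir
  put S σ a b τ x with τ Bool.≟ σ | x ≟ a
  ... | yes _ | yes _ = b
  ... | yes _ | no _ = S τ x
  ... | no _ | _ = S τ x

  put-hit : ∀ S σ a b → put S σ a b σ a ≡ b
  put-hit S σ a b with σ Bool.≟ σ | a ≟ a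
  ... | yes _ | yes _ = refl
  ... | yes _ | no a≢a = ⊥-elim (a≢a refl)
  ... | no σ≢σ | _ = ⊥-elim (σ≢σ refl)

  put-miss : ∀ S σ a b τ x → τ ≢ σ ⊎ x ≢ a → put S σ a b τ x ≡ S τ x
  put-miss S σ a b τ x h with τ Bool.≟ σ | x ≟ a
  ... | no _ | _ = refl
  ... | yes _ | no _ = refl
  put-miss S σ a b τ x (inj₁ τ≢σ) | yes τ≡σ | yes _ = ⊥-elim (τ≢σ τ≡σ)
  put-miss S σ a b τ x (inj₂ x≢a) | yes _ | yes x≡a = ⊥-elim (x≢a x≡a)

  put-true : ∀ S σ a b τ x → put S σ a b τ x ≡ true → (τ ≡ σ × x ≡ a) ⊎ S τ x ≡ true
  put-true S σ a b τ x eq with τ Bool.≟ σ | x ≟ a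
  ... | yes τ≡σ | yes x≡a = inj₁ (τ≡σ , x≡a)
  ... | yes _ | no _ = inj₂ eq
  ... | no _ | _ = inj₂ eq

-- Φ f d u b: the coloring computed from f gives the pair {d,u} the colour b.
module Forcing (em : ExcludedMiddle 0ℓ) (Φ : Coloring → ℕ → ℕ → Bool → Set)
               (Φ-det : ∀ {f d u b b′} → Φ f d u b → Φ f d u b′ → b ≡ b′)
               (Φ-use : ∀ {f d u b} → Φ f d u b →
                        ∃ λ k → ∀ f′ → AgreePairs k f f′ → Φ f′ d u b) where
  open Classical em

  -- The negative form covers computations that diverge. If it fails, some extension computes the
  -- wrong colour, and `force` turns that into a condition.
  Locks : Condition → ℕ → ℕ → Bool → Set
  Locks q d N c = ∀ f → f extends q → ∀ v → N ≤ v → ¬ Φ f d v (not c)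

  Locks-mono : ∀ {q q′ d N N′ c} → q′ ⊑ q → N ≤ N′ → Locks q d N c → Locks q′ d N′ c
  Locks-mono q′⊑q N≤N′ l f fe v N′≤v = l f (extends-⊑ q′⊑q fe) v (≤-trans N≤N′ N′≤v)

  record Good (q : Condition) : Set where
    field
      total : ∀ q′ → q′ ⊑ q → ∀ d u → ∃ λ f → f extends q′ × ∃ (Φ f d u)
      stable : ∀ q′ → q′ ⊑ q → ∀ d → ∃ λ q″ → q″ ⊑ q′ × ∃ λ N → ∃ λ c → Locks q″ d N c
  open Good public

  -- The clause `bound s ≤ u` protects the colour of the present L against all numbers to come, not
  -- just against the present R. Hence R may grow freely (`ROnly-valid`), while a new element of L
  -- has to be locked first.
  Valid : Bool → Condition → Stem → Set
  Valid c q s = ∀ d u → d < bound s → members s false d ≡ true → d < u →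
                bound s ≤ u ⊎ members s true u ≡ true → ∀ f → f extends q → ¬ Φ f d u (not c)

  Valid-⊑ : ∀ {c q q′ s} → q′ ⊑ q → Valid c q s → Valid c q′ s
  Valid-⊑ q′⊑q v d u p x d<u r f fe = v d u p x d<u r f (extends-⊑ q′⊑q fe)

  force : ∀ {q f d u b} → f extends q → Φ f d u b →
          ∃ λ q′ → q′ ⊑ q × (∀ f′ → f′ extends q′ → Φ f′ d u b)
  force {q} {f} fq φ with Φ-use φ
  ... | k , h = truncate q f k , truncate-⊑ q f k , λ f′ f′e → h f′ (truncate-agree q f k fq f′ f′e)

  -- The hereditary failure of `AlwaysActive`, in the form used by the stages: beyond `m`, and after
  -- any growth of R inside `A″`, each single output can be denied by thinning.
  Inactive : Functional → Bool → Condition → Reservoir → Stem → Set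
  Inactive γ c q A s = ∀ q′ → q′ ⊑ q → ∀ A′ → A′ ⊆ A → AllInfinite A′ → ∀ s′ → Ext A s s′ →
    Valid c q′ s′ → ∃ λ A″ → A″ ⊆ A′ × AllInfinite A″ × ∃ λ m → ∀ s″ → ROnly A″ s′ s″ →
    ∀ A₃ → A₃ ⊆ A″ → AllInfinite A₃ → ∀ τ w → m ≤ w → ¬ Undeniable γ s″ A₃ τ w

  abstract
    deny : ∀ γ s A τ w → ¬ Undeniable γ s A τ w →
           ∃ λ A′ → A′ ⊆ A × AllInfinite A′ × (∀ s′ → Ext A′ s s′ → ¬ Out γ s′ τ w)
    deny γ s A τ w ¬und = dne λ none → ¬und λ A′ A′⊆A inf → dne λ ¬s →
      none (A′ , A′⊆A , inf , λ s′ e o → ¬s (s′ , e , o))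

    thin-all : {X : Set} (A₀ : Reservoir) (P : X → Reservoir → ℕ → Set) →
      (∀ {x A A′ m m′} → A′ ⊆ A → m ≤ m′ → P x A m → P x A′ m′) → (xs : List X) →
      (∀ x → x ∈ xs → ∀ A → A ⊆ A₀ → AllInfinite A →
         ∃ λ A′ → A′ ⊆ A × AllInfinite A′ × ∃ λ m → P x A′ m) →
      AllInfinite A₀ →
      ∃ λ A′ → A′ ⊆ A₀ × AllInfinite A′ × ∃ λ m → ∀ x → x ∈ xs → P x A′ m
    thin-all A₀ P mono [] each inf = A₀ , (λ _ _ a → a) , inf , 0 , λ _ ()
    thin-all A₀ P mono (x ∷ xs) each inf
      with thin-all A₀ P mono xs (λ y y∈ → each y (there y∈)) inf
    ... | A₁ , A₁⊆A₀ , inf₁ , m₁ , all₁ with each x (here refl) A₁ A₁⊆A₀ inf₁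
    ... | A₂ , A₂⊆A₁ , inf₂ , m₂ , px = A₂ , ⊆-trans A₂⊆A₁ A₁⊆A₀ , inf₂ , m₁ ⊔ m₂ , all
      where
      all : ∀ y → y ∈ x ∷ xs → P y A₂ (m₁ ⊔ m₂)
      all y (here refl) = mono (λ _ _ a → a) (m≤n⊔m m₁ m₂) px
      all y (there y∈) = mono A₂⊆A₁ (m≤m⊔n m₁ m₂) (all₁ y y∈)

    lock-all : ∀ {q₀} → Good q₀ → ∀ ds q → q ⊑ q₀ →
               ∃ λ q′ → q′ ⊑ q × ∃ λ N → ∀ e → e ∈ ds → ∃ λ c → Locks q′ e N c
    lock-all good [] q q⊑ = q , ⊑-refl , 0 , λ _ ()
    lock-all good (d ∷ ds) q q⊑ with lock-all good ds q q⊑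
    ... | q₁ , q₁⊑q , N₁ , l₁ with stable good q₁ (⊑-trans q₁⊑q q⊑) d
    ... | q₂ , q₂⊑q₁ , N₂ , c , l₂ = q₂ , ⊑-trans q₂⊑q₁ q₁⊑q , N₁ ⊔ N₂ , all
      where
      all : ∀ e → e ∈ d ∷ ds → ∃ λ c → Locks q₂ e (N₁ ⊔ N₂) c
      all e (here refl) = c , Locks-mono {q₂} ⊑-refl (m≤n⊔m N₁ N₂) l₂
      all e (there e∈) = let (c′ , l) = l₁ e e∈ in c′ , Locks-mono q₂⊑q₁ (m≤m⊔n N₁ N₂) l

    -- Earlier evaluations survive the extension made for a new one because they look only at pairs
    -- below `k₁ ≤ rows q₁`, whose rows are already fixed.
    eval-all : ∀ {q₀} → Good q₀ → ∀ ρ ds q → q ⊑ q₀ →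
               ∃ λ q′ → q′ ⊑ q × ∃ λ k → k ≤ rows q′ ×
               (∀ e → e ∈ ds → ∃ λ b → ∀ f → AgreePairs k (coloring q′) f → Φ f e ρ b)
    eval-all good ρ [] q q⊑ = q , ⊑-refl , 0 , z≤n , λ _ ()
    eval-all good ρ (d ∷ ds) q q⊑ with eval-all good ρ ds q q⊑
    ... | q₁ , q₁⊑q , k₁ , k₁≤ , ev₁ with total good q₁ (⊑-trans q₁⊑q q⊑) d ρ
    ... | g , gq₁ , b , φ with Φ-use φ
    ... | k₂ , u₂ = q₂ , ⊑-trans q₂⊑q₁ q₁⊑q , k₁ ⊔ k₂ ,
                    ⊔-lub (≤-trans k₁≤ (m≤m⊔n (rows q₁) k₂)) (m≤n⊔m (rows q₁) k₂) , all
      where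
      q₂ : Condition
      q₂ = truncate q₁ g k₂
      q₂⊑q₁ : q₂ ⊑ q₁
      q₂⊑q₁ = truncate-⊑ q₁ g k₂
      all : ∀ e → e ∈ d ∷ ds → ∃ λ b → ∀ f → AgreePairs (k₁ ⊔ k₂) (coloring q₂) f → Φ f e ρ b
      all e (here refl) = b , λ f a → u₂ f λ x y x<y y<k₂ →
        trans (a x y x<y (<-≤-trans y<k₂ (m≤n⊔m k₁ k₂)))
              (truncate-agree q₁ g k₂ gq₁ (coloring q₂) (extends-self q₂) x y x<y y<k₂)
      all e (there e∈) = let (b′ , ev) = ev₁ e e∈ in b′ , λ f a → ev f λ x y x<y y<k₁ →
        trans (a x y x<y (<-≤-trans y<k₁ (m≤m⊔n k₁ k₂)))
              (same-rows q₂⊑q₁ x (<-≤-trans (<-trans x<y y<k₁) k₁≤) y)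

    -- Ramsey's theorem needs the colour as a function. Both colours are locked only if no
    -- computation in question converges; then `true` is taken.
    lock-colour : Condition → ℕ → ℕ → Bool
    lock-colour q N e = truth (Locks q e N true)

    lock-colour-correct : ∀ {q N e} → (∃ λ c → Locks q e N c) → Locks q e N (lock-colour q N e)
    lock-colour-correct {q} {N} {e} (c , l) with em {Locks q e N true}
    lock-colour-correct (c , l) | yes l′ = l′
    lock-colour-correct (false , l) | no ¬l = l
    lock-colour-correct (true , l) | no ¬l = ⊥-elim (¬l l)

-- The stage construction

false≢true : ∀ {b : Bool} → b ≡ false → b ≡ true → ⊥
false≢true refl ()

bool-unless : ∀ {a b : Bool} → ¬ (a ≡ not b) → a ≡ b
bool-unless {true} {true} _ = refl
bool-unless {false} {false} _ = refl
bool-unless {true} {false} h = ⊥-elim (h refl)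
bool-unless {false} {true} h = ⊥-elim (h refl)

not-fixed : ∀ {b : Bool} → not b ≢ b
not-fixed {true} ()
not-fixed {false} ()

EmptyFrom : ℕ → Reservoir → Set
EmptyFrom κ S = ∀ τ x → κ ≤ x → S τ x ≡ false

put-empty : ∀ {S κ σ a b} → EmptyFrom κ S → κ ≤ a → EmptyFrom (suc a) (put S σ a b)
put-empty {S} {σ = σ} {a} {b} e κ≤a τ x a<x =
  trans (put-miss S σ a b τ x (inj₂ λ x≡a → <⇒≢ a<x (sym x≡a))) (e τ x (≤-trans κ≤a (<⇒≤ a<x)))

EmptyFrom-mono : ∀ {S k k′} → k ≤ k′ → EmptyFrom k S → EmptyFrom k′ S
EmptyFrom-mono k≤k′ e τ x k′≤x = e τ x (≤-trans k≤k′ k′≤x)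

lengthen : ∀ {A S k k′} → EmptyFrom k S → k ≤ k′ → Ext A (stem S k) (stem S k′)
lengthen e k≤k′ = ext k≤k′ (λ _ _ _ → refl)
  (λ τ x k≤x _ x∈ → ⊥-elim (false≢true (e τ x k≤x) x∈))

put-Ext : ∀ {A S κ k σ a b} → EmptyFrom κ S → κ ≤ k → k ≤ a → A σ a ≡ true →
          Ext A (stem S k) (stem (put S σ a b) (suc a))
put-Ext {A} {S} {κ} {k} {σ} {a} {b} e κ≤k k≤a a∈A = ext (m≤n⇒m≤1+n k≤a)
  (λ τ x x<k → put-miss S σ a b τ x (inj₂ (<⇒≢ (<-≤-trans x<k k≤a)))) nw
  where
  nw : ∀ τ x → k ≤ x → x < suc a → put S σ a b τ x ≡ true → A τ x ≡ true
  nw τ x k≤x _ x∈ with put-true S σ a b τ x x∈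
  ... | inj₁ (refl , refl) = a∈A
  ... | inj₂ x∈S = ⊥-elim (false≢true (e τ x (≤-trans κ≤k k≤x)) x∈S)

-- Erasing what lies beyond the bound allows the bound to be raised without acquiring members.
restrict : Stem → Reservoir
restrict s τ x = if x <ᵇ bound s then members s τ x else false

restrict-empty : ∀ s → EmptyFrom (bound s) (restrict s)
restrict-empty s τ x k≤x = if-false (<ᵇ-false k≤x)

restrict-Ext : ∀ {A} s k → bound s ≤ k → Ext A s (stem (restrict s) k)
restrict-Ext s k b≤k = ext b≤k (λ τ x x<b → if-true (<ᵇ-true x<b))
  (λ τ x b≤x _ x∈ → ⊥-elim (false≢true (restrict-empty s τ x b≤x) x∈))

bools : List Bool
bools = true ∷ false ∷ []

∈-bools : ∀ b → b ∈ bools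
∈-bools true = here refl
∈-bools false = there (here refl)

module Stages (em : ExcludedMiddle 0ℓ) (Φ : Coloring → ℕ → ℕ → Bool → Set)
              (Φ-det : ∀ {f d u b b′} → Φ f d u b → Φ f d u b′ → b ≡ b′)
              (Φ-use : ∀ {f d u b} → Φ f d u b →
                       ∃ λ k → ∀ f′ → AgreePairs k f f′ → Φ f′ d u b) where
 open Classical em
 open Forcing em Φ Φ-det Φ-use

 module Sequence (q₀ : Condition) (good : Good q₀)
                 (W : Subset) (wb : ℕ) (W-≥ : ∀ x → W x ≡ true → rows q₀ ≤ x)
                 (W-< : ∀ x → W x ≡ true → x < wb)
                 (A₀ : Reservoir) (A₀-inf : AllInfinite A₀)
                 (γ : Bool → Functional) (base : Bool → Stem)
                 (inact : ∀ c → Inactive (γ c) c q₀ A₀ (base c)) where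

  -- Later colorings agree with h on pairs below u.  The elements chosen so far are below κ, those meant
  -- for L are listed in ds, and stems holds all stems formed from them for either colour.  Rows in W
  -- are 0.
  record Stage : Set where
    field
      u κ : ℕ
      h : Coloring
      ds : List ℕ
      A : Reservoir
      stems : List (Bool × Reservoir)
      rows≤u : rows q₀ ≤ u
      wb≤u : wb ≤ u
      u≤κ : u ≤ κ
      ds<κ : ∀ e → e ∈ ds → e < κ
      h-q₀ : h extends q₀
      h-W : ∀ x → W x ≡ true → ∀ y → h x y ≡ false
      A-inf : AllInfinite A
      A⊆A₀ : A ⊆ A₀
      stems-Ext : ∀ c S → (c , S) ∈ stems → Ext A₀ (base c) (stem S κ)
      stems-empty : ∀ c S → (c , S) ∈ stems → EmptyFrom κ S

  -- The condition under which the stem will be valid belongs to a later stage, so only its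
  -- existence is asked for. The bound `k` may exceed `κ` because locks take effect late.
  Realizable : ℕ → Bool → Reservoir → Set
  Realizable κ c S = ∃ λ k → κ ≤ k × ∃ λ q → q ⊑ q₀ × Valid c q (stem S k)

  -- All four choices are recorded since the index set `K` is known only after all stages are built.
  variant : ℕ → ℕ → Bool × Reservoir → Bool × Bool → Bool × Reservoir
  variant ρ d (c , S) (b , b′) = c , put (put S true ρ b) false d b′

  -- Later stages retain from `q` only pairs below `u s′`, through `h s′`. This lets the rows be 0
  -- on the next interval and still receive the limit 1 again. `evals` rescues the locked colours at
  -- `ρ` as facts about those pairs.
  record Step (s s′ : Stage) : Set where
    open Stage
    field
      m ρ d : ℕ
      q : Condition
      t : ℕ → Bool
      κ≤m : κ s ≤ m
      m≤ρ : m ≤ ρ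
      ρ<u : ρ < u s′
      u≤d : u s′ ≤ d
      κ-suc : κ s′ ≡ suc d
      d∈A : A s′ false d ≡ true
      ρ∈A : A s true ρ ≡ true
      A⊆A : A s′ ⊆ A s
      q⊑q₀ : q ⊑ q₀
      m≤rows : m ≤ rows q
      q-old : ∀ x y → x < m → y < u s → coloring q x y ≡ h s x y
      q-gap : ∀ x y → rows q₀ ≤ x → x < m → W x ≡ false → u s ≤ y → y < m →
              coloring q x y ≡ false
      q-lim : ∀ x y → rows q₀ ≤ x → x < m → W x ≡ false → m ≤ y → coloring q x y ≡ true
      q-W : ∀ x y → W x ≡ true → coloring q x y ≡ false
      locks : ∀ e → e ∈ ds s → Locks q e ρ (t e)
      h-q : h s′ extends q
      evals : ∀ e → e ∈ ds s → ∀ f → AgreePairs (u s′) (h s′) f → Φ f e ρ (t e)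
      ds-suc : ds s′ ≡ d ∷ ds s
      denied : ∀ c S → (c , S) ∈ stems s → Realizable (κ s) c S → ∀ b τ w → m ≤ w → w < u s′ →
               ∀ s″ → Ext (A s′) (stem (put S true ρ b) (u s′)) s″ → ¬ Out (γ c) s″ τ w
      stems-suc : ∀ c S → (c , S) ∈ stems s → ∀ bs → variant ρ d (c , S) bs ∈ stems s′

  module Build (s : Stage) where
    open Stage s

    Bounded : Bool × Reservoir → Reservoir → ℕ → Set
    Bounded (c , S) A m = Realizable κ c S → ∃ λ k → κ ≤ k × k ≤ m × (∀ s″ → ROnly A (stem S k) s″ →
      ∀ A₃ → A₃ ⊆ A → AllInfinite A₃ → ∀ τ w → m ≤ w → ¬ Undeniable (γ c) s″ A₃ τ w)

    Bounded-mono : ∀ {x A A′ m m′} → A′ ⊆ A → m ≤ m′ → Bounded x A m → Bounded x A′ m′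
    Bounded-mono A′⊆A m≤m′ b r with b r
    ... | k , κ≤k , k≤m , h = k , κ≤k , ≤-trans k≤m m≤m′ , λ s″ ro A₃ A₃⊆ inf τ w m′≤w →
      h s″ (r-only (Ext-⊆ A′⊆A (extension ro)) (none ro)) A₃ (⊆-trans A₃⊆ A′⊆A) inf τ w
        (≤-trans m≤m′ m′≤w)

    bounded-each : ∀ x → x ∈ stems → ∀ B → B ⊆ A → AllInfinite B →
                   ∃ λ A′ → A′ ⊆ B × AllInfinite A′ × ∃ λ m → Bounded x A′ m
    bounded-each (c , S) x∈ B B⊆A inf with em {Realizable κ c S}
    ... | no ¬r = B , (λ _ _ a → a) , inf , 0 , λ r → ⊥-elim (¬r r)
    ... | yes (k , κ≤k , q , q⊑ , v)
      with inact c q q⊑ B (⊆-trans B⊆A A⊆A₀) inf (stem S k)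
             (Ext-trans (stems-Ext c S x∈) (lengthen (stems-empty c S x∈) κ≤k)) v
    ...   | A′ , A′⊆B , inf′ , m , h = A′ , A′⊆B , inf′ , k ⊔ m , λ _ → k , κ≤k , m≤m⊔n k m ,
      λ s″ ro A₃ A₃⊆ inf₃ τ w km≤w → h s″ ro A₃ A₃⊆ inf₃ τ w (≤-trans (m≤n⊔m k m) km≤w)

    abstract
      thin₁ : ∃ λ A′ → A′ ⊆ A × AllInfinite A′ × ∃ λ m → ∀ x → x ∈ stems → Bounded x A′ m
      thin₁ = thin-all A Bounded (λ {x} → Bounded-mono {x}) stems bounded-each A-inf

    A₁ : Reservoir
    A₁ = proj₁ thin₁
    A₁⊆A : A₁ ⊆ A
    A₁⊆A = proj₁ (proj₂ thin₁)
    A₁-inf : AllInfinite A₁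
    A₁-inf = proj₁ (proj₂ (proj₂ thin₁))
    m₁ : ℕ
    m₁ = proj₁ (proj₂ (proj₂ (proj₂ thin₁)))
    bounded₁ : ∀ x → x ∈ stems → Bounded x A₁ m₁
    bounded₁ = proj₂ (proj₂ (proj₂ (proj₂ thin₁)))

    m = κ ⊔ m₁

    κ≤m : κ ≤ m
    κ≤m = m≤m⊔n κ m₁

    u≤m : u ≤ m
    u≤m = ≤-trans u≤κ κ≤m

    pattern₁ : Coloring
    pattern₁ x y = if x <ᵇ rows q₀ then coloring q₀ x y else
                   if W x then false else if y <ᵇ u then h x y else if y <ᵇ m then false else true

    pattern₁-convergent : ∀ x → Convergent (pattern₁ x)
    pattern₁-convergent x with x <ᵇ rows q₀
    ... | true = convergent q₀ x
    ... | false with W x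
    ...   | true = false , 0 , λ _ _ → refl
    ...   | false = true , m , λ y m≤y →
      trans (if-false (<ᵇ-false (≤-trans u≤m m≤y))) (if-false (<ᵇ-false m≤y))

    q₁ : Condition
    q₁ = record { rows = m ; coloring = pattern₁ ; convergent = pattern₁-convergent }

    q₁⊑q₀ : q₁ ⊑ q₀
    q₁⊑q₀ = ≤-trans rows≤u u≤m , λ x x<n y → if-true (<ᵇ-true x<n)

    q₁-W : ∀ x y → W x ≡ true → pattern₁ x y ≡ false
    q₁-W x y Wx = trans (if-false (<ᵇ-false (W-≥ x Wx))) (if-true Wx)

    q₁-free : ∀ x y → rows q₀ ≤ x → W x ≡ false →
              pattern₁ x y ≡ (if y <ᵇ u then h x y else if y <ᵇ m then false else true)
    q₁-free x y n≤x Wx = trans (if-false (<ᵇ-false n≤x)) (if-false Wx)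

    q₁-old : ∀ x y → y < u → pattern₁ x y ≡ h x y
    q₁-old x y y<u with x <? rows q₀
    ... | yes x<n = trans (if-true (<ᵇ-true x<n)) (sym (h-q₀ x x<n y))
    ... | no x≮n with W x in Wx
    ...   | true = trans (if-false (<ᵇ-false (≮⇒≥ x≮n))) (sym (h-W x Wx y))
    ...   | false = trans (if-false (<ᵇ-false (≮⇒≥ x≮n))) (if-true (<ᵇ-true y<u))

    abstract
      locked : ∃ λ q → q ⊑ q₁ × ∃ λ N → ∀ e → e ∈ ds → ∃ λ c → Locks q e N c
      locked = lock-all good ds q₁ q₁⊑q₀

    q₂ : Condition
    q₂ = proj₁ locked
    q₂⊑q₁ : q₂ ⊑ q₁
    q₂⊑q₁ = proj₁ (proj₂ locked)
    N : ℕ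
    N = proj₁ (proj₂ (proj₂ locked))

    q₂⊑q₀ : q₂ ⊑ q₀
    q₂⊑q₀ = ⊑-trans q₂⊑q₁ q₁⊑q₀

    t : ℕ → Bool
    t = lock-colour q₂ N

    t-locks : ∀ e → e ∈ ds → Locks q₂ e N (t e)
    t-locks e e∈ = lock-colour-correct (proj₂ (proj₂ (proj₂ locked)) e e∈)

    abstract
      picked : ∃ λ x → m ⊔ N ≤ x × A₁ true x ≡ true
      picked = A₁-inf true (m ⊔ N)

    ρ : ℕ
    ρ = proj₁ picked
    ρ∈A₁ : A₁ true ρ ≡ true
    ρ∈A₁ = proj₂ (proj₂ picked)

    m≤ρ : m ≤ ρ
    m≤ρ = ≤-trans (m≤m⊔n m N) (proj₁ (proj₂ picked))

    N≤ρ : N ≤ ρ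
    N≤ρ = ≤-trans (m≤n⊔m m N) (proj₁ (proj₂ picked))

    abstract
      evaluated : ∃ λ q → q ⊑ q₂ × ∃ λ k → k ≤ rows q ×
        (∀ e → e ∈ ds → ∃ λ b → ∀ f → AgreePairs k (coloring q) f → Φ f e ρ b)
      evaluated = eval-all good ρ ds q₂ q₂⊑q₀

    q₃ : Condition
    q₃ = proj₁ evaluated
    q₃⊑q₂ : q₃ ⊑ q₂
    q₃⊑q₂ = proj₁ (proj₂ evaluated)
    k₃ : ℕ
    k₃ = proj₁ (proj₂ (proj₂ evaluated))

    -- Past `ρ` and past the use `k₃` of the evaluations at `ρ`, so that freezing the pairs below it
    -- preserves them.
    u′ : ℕ
    u′ = suc ρ ⊔ k₃

    -- The lock merely excludes the colour `not (t e)`; as `q₃` makes the computation at `ρ ≥ N`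
    -- converge, its value must be `t e`.
    evals : ∀ e → e ∈ ds → ∀ f → AgreePairs u′ (coloring q₃) f → Φ f e ρ (t e)
    evals e e∈ f a = subst (Φ f e ρ) (bool-unless λ b≡ →
        t-locks e e∈ (coloring q₃) (same-rows q₃⊑q₂) ρ N≤ρ
          (subst (Φ (coloring q₃) e ρ) b≡ (proj₂ ev (coloring q₃) λ _ _ _ _ → refl)))
      (proj₂ ev f λ x y x<y y<k → a x y x<y (<-≤-trans y<k (m≤n⊔m (suc ρ) k₃)))
      where ev = proj₂ (proj₂ (proj₂ (proj₂ evaluated))) e e∈

    Task : Set
    Task = (Bool × Reservoir) × (Bool × (Bool × ℕ))

    Denied : Task → Reservoir → ℕ → Set
    Denied ((c , S) , b , τ , w) A _ = Realizable κ c S → m ≤ w → ∀ s″ →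
      Ext A (stem (put S true ρ b) u′) s″ → ¬ Out (γ c) s″ τ w

    tasks : List Task
    tasks = cartesianProduct stems (cartesianProduct bools (cartesianProduct bools (upTo u′)))

    -- Putting `ρ` into R, or leaving it out, is an R-only extension, so the bound from inactivity
    -- applies. Adding `d` to L would not be one; therefore `d` is picked after this thinning, from
    -- the thinned set and not below `u′`.
    denied-realizable : ∀ c S b τ w → (c , S) ∈ stems → Realizable κ c S → m ≤ w →
      ∀ B → B ⊆ A₁ → AllInfinite B →
      ∃ λ A′ → A′ ⊆ B × AllInfinite A′ × ∃ λ k → Denied ((c , S) , b , τ , w) A′ k
    denied-realizable c S b τ w S∈ r m≤w B B⊆A₁ inf =
      proj₁ thinned , proj₁ (proj₂ thinned) , proj₁ (proj₂ (proj₂ thinned)) , 0 , λ _ _ s″ e →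
        proj₂ (proj₂ (proj₂ thinned)) s″ (Ext-trans (lengthen
          (put-empty (stems-empty c S S∈) (≤-trans κ≤m m≤ρ)) (m≤m⊔n (suc ρ) k₃)) e)
      where
      bd = bounded₁ (c , S) S∈ r
      κ≤k = proj₁ (proj₂ bd)
      k≤ρ = ≤-trans (proj₁ (proj₂ (proj₂ bd))) (≤-trans (m≤n⊔m κ m₁) m≤ρ)
      s₁ : Stem
      s₁ = stem (put S true ρ b) (suc ρ)
      r-only₁ : ROnly A₁ (stem S (proj₁ bd)) s₁
      r-only₁ = r-only (put-Ext (stems-empty c S S∈) κ≤k k≤ρ ρ∈A₁)
        (λ x k≤x _ → trans (put-miss S true ρ b false x (inj₁ λ ()))
                           (stems-empty c S S∈ false x (≤-trans κ≤k k≤x)))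
      thinned = deny (γ c) s₁ B τ w
        (proj₂ (proj₂ (proj₂ bd)) s₁ r-only₁ B B⊆A₁ inf τ w (≤-trans (m≤n⊔m κ m₁) m≤w))

    denied-each : ∀ x → x ∈ tasks → ∀ B → B ⊆ A₁ → AllInfinite B →
                  ∃ λ A′ → A′ ⊆ B × AllInfinite A′ × ∃ λ k → Denied x A′ k
    denied-each ((c , S) , b , τ , w) x∈ B B⊆A₁ inf = by-cases (em {Realizable κ c S}) (m ≤? w)
      where
      by-cases : Dec (Realizable κ c S) → Dec (m ≤ w) →
        ∃ λ A′ → A′ ⊆ B × AllInfinite A′ × ∃ λ k → Denied ((c , S) , b , τ , w) A′ k
      by-cases (no ¬r) _ = B , (λ _ _ a → a) , inf , 0 , λ r → ⊥-elim (¬r r)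
      by-cases (yes _) (no m≰w) = B , (λ _ _ a → a) , inf , 0 , λ _ m≤w → ⊥-elim (m≰w m≤w)
      by-cases (yes r) (yes m≤w) =
        denied-realizable c S b τ w (proj₁ (∈-cartesianProduct⁻ stems _ x∈)) r m≤w B B⊆A₁ inf

    abstract
      thin₂ : ∃ λ A′ → A′ ⊆ A₁ × AllInfinite A′ × ∃ λ k → ∀ x → x ∈ tasks → Denied x A′ k
      thin₂ = thin-all A₁ Denied
        (λ {x} A′⊆A _ D r m≤w s″ e → D r m≤w s″ (Ext-⊆ A′⊆A e)) tasks denied-each A₁-inf

    A₂ : Reservoir
    A₂ = proj₁ thin₂
    A₂⊆A : A₂ ⊆ A
    A₂⊆A = ⊆-trans (proj₁ (proj₂ thin₂)) A₁⊆A
    A₂-inf : AllInfinite A₂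
    A₂-inf = proj₁ (proj₂ (proj₂ thin₂))
    denied₂ : ∀ x → x ∈ tasks → Denied x A₂ 0
    denied₂ = proj₂ (proj₂ (proj₂ (proj₂ thin₂)))

    abstract
      picked₂ : ∃ λ x → u′ ≤ x × A₂ false x ≡ true
      picked₂ = A₂-inf false u′

    d : ℕ
    d = proj₁ picked₂
    u′≤d : u′ ≤ d
    u′≤d = proj₁ (proj₂ picked₂)
    d∈A₂ : A₂ false d ≡ true
    d∈A₂ = proj₂ (proj₂ picked₂)

    u≤u′ : u ≤ u′
    u≤u′ = ≤-trans u≤m (≤-trans m≤ρ (≤-trans (n≤1+n ρ) (m≤m⊔n (suc ρ) k₃)))

    κ≤ρ : κ ≤ ρ
    κ≤ρ = ≤-trans κ≤m m≤ρ

    ρ<d : ρ < d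
    ρ<d = ≤-trans (m≤m⊔n (suc ρ) k₃) u′≤d

    stems′ : List (Bool × Reservoir)
    stems′ = cartesianProductWith (variant ρ d) stems (cartesianProduct bools bools)

    variant-Ext : ∀ c S → (c , S) ∈ stems → ∀ b b′ →
      Ext A₀ (base c) (stem (proj₂ (variant ρ d (c , S) (b , b′))) (suc d))
    variant-Ext c S S∈ b b′ = Ext-trans (stems-Ext c S S∈) (Ext-trans
      (put-Ext (stems-empty c S S∈) ≤-refl κ≤ρ (A⊆A₀ true ρ (A₁⊆A true ρ ρ∈A₁)))
      (put-Ext (put-empty (stems-empty c S S∈) κ≤ρ) ≤-refl ρ<d (A⊆A₀ false d (A₂⊆A false d d∈A₂))))

    next : Stage
    next = record
      { u = u′ ; κ = suc d ; h = coloring q₃ ; ds = d ∷ ds ; A = A₂ ; stems = stems′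
      ; rows≤u = ≤-trans rows≤u u≤u′
      ; wb≤u = ≤-trans wb≤u u≤u′
      ; u≤κ = m≤n⇒m≤1+n u′≤d
      ; ds<κ = λ { e (here refl) → n<1+n d
                 ; e (there e∈) → m<n⇒m<1+n (<-trans (<-≤-trans (ds<κ e e∈) κ≤ρ) ρ<d) }
      ; h-q₀ = same-rows (⊑-trans q₃⊑q₂ q₂⊑q₀)
      ; h-W = λ x Wx y → trans
          (same-rows (⊑-trans q₃⊑q₂ q₂⊑q₁) x (<-≤-trans (W-< x Wx) (≤-trans wb≤u u≤m)) y)
          (q₁-W x y Wx)
      ; A-inf = A₂-inf
      ; A⊆A₀ = ⊆-trans A₂⊆A A⊆A₀
      ; stems-Ext = λ c S S∈ → from-variants (λ { (c , S) → Ext A₀ (base c) (stem S (suc d)) })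
          (λ { (c , S) S∈ b b′ → variant-Ext c S S∈ b b′ }) S∈
      ; stems-empty = λ c S S∈ → from-variants (λ { (c , S) → EmptyFrom (suc d) S })
          (λ { (c , S) S∈ b b′ → put-empty (put-empty (stems-empty c S S∈) κ≤ρ) ρ<d }) S∈
      }
      where
      from-variants : (P : Bool × Reservoir → Set) →
        (∀ x → x ∈ stems → ∀ b b′ → P (variant ρ d x (b , b′))) → ∀ {y} → y ∈ stems′ → P y
      from-variants P h {y} y∈
        with ∈-cartesianProductWith⁻ (variant ρ d) stems (cartesianProduct bools bools) y∈
      ... | x , (b , b′) , x∈ , _ , refl = h x x∈ b b′

    step : Step s next
    step = record
      { m = m ; ρ = ρ ; d = d ; q = q₂ ; t = t
      ; κ≤m = κ≤m ; m≤ρ = m≤ρ ; ρ<u = m≤m⊔n (suc ρ) k₃ ; u≤d = u′≤d ; κ-suc = refl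
      ; d∈A = d∈A₂ ; ρ∈A = A₁⊆A true ρ ρ∈A₁ ; A⊆A = A₂⊆A ; q⊑q₀ = q₂⊑q₀
      ; m≤rows = more-rows q₂⊑q₁
      ; q-old = λ x y x<m y<u → trans (same-rows q₂⊑q₁ x x<m y) (q₁-old x y y<u)
      ; q-gap = λ x y n≤x x<m Wx u≤y y<m → trans (same-rows q₂⊑q₁ x x<m y)
          (trans (q₁-free x y n≤x Wx) (trans (if-false (<ᵇ-false u≤y)) (if-true (<ᵇ-true y<m))))
      ; q-lim = λ x y n≤x x<m Wx m≤y → trans (same-rows q₂⊑q₁ x x<m y)
          (trans (q₁-free x y n≤x Wx)
            (trans (if-false (<ᵇ-false (≤-trans u≤m m≤y))) (if-false (<ᵇ-false m≤y))))
      ; q-W = λ x y Wx → trans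
          (same-rows q₂⊑q₁ x (<-≤-trans (W-< x Wx) (≤-trans wb≤u u≤m)) y) (q₁-W x y Wx)
      ; locks = λ e e∈ → Locks-mono {q₂} ⊑-refl N≤ρ (t-locks e e∈)
      ; h-q = same-rows q₃⊑q₂
      ; evals = evals
      ; ds-suc = refl
      ; denied = λ c S S∈ r b τ w m≤w w<u′ → denied₂ ((c , S) , b , τ , w)
          (∈-cartesianProduct⁺ S∈ (∈-cartesianProduct⁺ (∈-bools b)
            (∈-cartesianProduct⁺ (∈-bools τ) (∈-upTo⁺ w<u′)))) r m≤w
      ; stems-suc = λ { c S S∈ (b , b′) → ∈-cartesianProductWith⁺ (variant ρ d) S∈
          (∈-cartesianProduct⁺ (∈-bools b) (∈-bools b′)) }
      }

  u₀ : ℕ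
  u₀ = (rows q₀ ⊔ wb) ⊔ (bound (base true) ⊔ bound (base false))

  base≤u₀ : ∀ c → bound (base c) ≤ u₀
  base≤u₀ true = ≤-trans (m≤m⊔n _ _) (m≤n⊔m (rows q₀ ⊔ wb) _)
  base≤u₀ false = ≤-trans (m≤n⊔m (bound (base true)) _) (m≤n⊔m (rows q₀ ⊔ wb) _)

  start : Stage
  start = record
    { u = u₀ ; κ = u₀ ; ds = [] ; A = A₀
    ; h = λ x y → if x <ᵇ rows q₀ then coloring q₀ x y else false
    ; stems = (true , restrict (base true)) ∷ (false , restrict (base false)) ∷ []
    ; rows≤u = ≤-trans (m≤m⊔n (rows q₀) wb) (m≤m⊔n _ _)
    ; wb≤u = ≤-trans (m≤n⊔m (rows q₀) wb) (m≤m⊔n _ _)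
    ; u≤κ = ≤-refl
    ; ds<κ = λ _ ()
    ; h-q₀ = λ x x<n y → if-true (<ᵇ-true x<n)
    ; h-W = λ x Wx y → if-false (<ᵇ-false (W-≥ x Wx))
    ; A-inf = A₀-inf
    ; A⊆A₀ = λ _ _ a → a
    ; stems-Ext = λ { c S (here refl) → restrict-Ext (base c) u₀ (base≤u₀ c)
                    ; c S (there (here refl)) → restrict-Ext (base c) u₀ (base≤u₀ c) }
    ; stems-empty = λ { c S (here refl) → EmptyFrom-mono (base≤u₀ c) (restrict-empty (base c))
                      ; c S (there (here refl)) →
                          EmptyFrom-mono (base≤u₀ c) (restrict-empty (base c)) }
    }

  abstract
    stage : ℕ → Stage
    stage = iterate {R = Step} (λ s → Build.next s , Build.step s) start

    stage-zero : stage 0 ≡ start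
    stage-zero = refl

    stage-step : ∀ n → Step (stage n) (stage (suc n))
    stage-step = iterate-step {R = Step} (λ s → Build.next s , Build.step s) start

  module At (n : ℕ) where
    open Stage (stage n) public
    open Step (stage-step n) public

  open At

  u<u : ∀ n → u n < u (suc n)
  u<u n = ≤-<-trans (≤-trans (u≤κ n) (≤-trans (κ≤m n) (m≤ρ n))) (ρ<u n)

  d<κ : ∀ n → d n < κ (suc n)
  d<κ n = ≤-reflexive (sym (κ-suc n))

  ρ<d : ∀ n → ρ n < d n
  ρ<d n = <-≤-trans (ρ<u n) (u≤d n)

  κ≤ρ : ∀ n → κ n ≤ ρ n
  κ≤ρ n = ≤-trans (κ≤m n) (m≤ρ n)

  u≤m : ∀ n → u n ≤ m n
  u≤m n = ≤-trans (u≤κ n) (κ≤m n)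

  κ<κ : ∀ n → κ n < κ (suc n)
  κ<κ n = <-trans (≤-<-trans (κ≤ρ n) (ρ<d n)) (d<κ n)

  u-mono : ∀ {i j} → i ≤ j → u i ≤ u j
  u-mono = transitive-chain {_≼_ = λ a b → b ≤ a} ≤-refl (λ p q → ≤-trans q p) u (λ n → <⇒≤ (u<u n))

  κ-mono : ∀ {i j} → i ≤ j → κ i ≤ κ j
  κ-mono = transitive-chain {_≼_ = λ a b → b ≤ a} ≤-refl (λ p q → ≤-trans q p) κ (λ n → <⇒≤ (κ<κ n))

  A-antitone : ∀ {i j} → i ≤ j → A j ⊆ A i
  A-antitone = transitive-chain {_≼_ = _⊆_} (λ _ _ a → a) ⊆-trans A A⊆A

  m<m : ∀ {i j} → i < j → m i < m j
  m<m {i} {j} i<j =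
    <-≤-trans (<-trans (≤-<-trans (m≤ρ i) (ρ<d i)) (d<κ i)) (≤-trans (κ-mono i<j) (κ≤m j))

  m-≥ : ∀ n → n ≤ m n
  m-≥ zero = z≤n
  m-≥ (suc n) = ≤-<-trans (m-≥ n) (m<m (n<1+n n))

  m-mono : ∀ {i j} → i ≤ j → m i ≤ m j
  m-mono i≤j with m≤n⇒m<n∨m≡n i≤j
  ... | inj₁ i<j = <⇒≤ (m<m i<j)
  ... | inj₂ refl = ≤-refl

  d∈ds : ∀ {i j} → i < j → d i ∈ ds j
  d∈ds {i} {suc j} i<1+j with m≤n⇒m<n∨m≡n (≤-pred i<1+j)
  ... | inj₁ i<j = subst (d i ∈_) (sym (ds-suc j)) (there (d∈ds i<j))
  ... | inj₂ refl = subst (d i ∈_) (sym (ds-suc j)) (here refl)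

  h-agree-suc : ∀ n → AgreePairs (u n) (h n) (h (suc n))
  h-agree-suc n x y x<y y<u = trans (h-q n x (<-≤-trans x<m (m≤rows n)) y) (q-old n x y x<m y<u)
    where
    x<m : x < m n
    x<m = <-≤-trans (<-trans x<y y<u) (u≤m n)

  h-agree : ∀ {i j} → i ≤ j → AgreePairs (u i) (h i) (h j)
  h-agree i≤j = go (≤⇒≤′ i≤j)
    where
    go : ∀ {i j} → i ≤′ j → AgreePairs (u i) (h i) (h j)
    go ≤′-refl _ _ _ _ = refl
    go (≤′-step {n = n} i≤′n) x y x<y y<u = trans
      (h-agree-suc n x y x<y (<-≤-trans y<u (u-mono (≤′⇒≤ i≤′n)))) (go i≤′n x y x<y y<u)

  q-agree : ∀ {i l f} → i ≤ l → f extends q l → AgreePairs (u i) (h i) f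
  q-agree {i} {l} i≤l fe x y x<y y<u = trans (fe x (<-≤-trans x<m (m≤rows l)) y)
    (trans (q-old l x y x<m (<-≤-trans y<u (u-mono i≤l))) (h-agree i≤l x y x<y y<u))
    where
    x<m : x < m l
    x<m = <-≤-trans (<-trans x<y y<u) (≤-trans (u-mono i≤l) (u≤m l))

  -- Strictness of `j < l` matters: the evaluation at `ρ j` is frozen in `h (suc j)`, which `q l`
  -- follows once `suc j ≤ l`.
  settled : ∀ {i j l f} → i < j → j < l → f extends q l → Φ f (d i) (ρ j) (t j (d i))
  settled {j = j} i<j j<l fe = evals j _ (d∈ds i<j) _ (q-agree j<l fe)

  -- For `j < l` the zeros are inherited: `h (suc j)` extends `q j`, and `q l` agrees with
  -- `h (suc j)` below `u (suc j)`.
  gap : ∀ {j l f} → j ≤ l → f extends q l → ∀ x y → rows q₀ ≤ x → x < y → W x ≡ false →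
        u j ≤ y → y < m j → f x y ≡ false
  gap {j} {l} j≤l fe x y n≤x x<y Wx u≤y y<m with m≤n⇒m<n∨m≡n j≤l
  ... | inj₂ refl = trans (fe x (<-≤-trans (<-trans x<y y<m) (m≤rows l)) y)
                          (q-gap l x y n≤x (<-trans x<y y<m) Wx u≤y y<m)
  ... | inj₁ j<l = trans (q-agree j<l fe x y x<y (<-trans (<-≤-trans y<m (m≤ρ j)) (ρ<u j)))
    (trans (h-q j x (<-≤-trans (<-trans x<y y<m) (m≤rows j)) y)
           (q-gap j x y n≤x (<-trans x<y y<m) Wx u≤y y<m))

  locate : ∀ l y → u 0 ≤ y → y < u (suc l) → ∃ λ j → j ≤ l × u j ≤ y × y < u (suc j)
  locate zero y u≤y y<u = 0 , ≤-refl , u≤y , y<u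
  locate (suc l) y u≤y y<u with y <? u (suc l)
  ... | no y≮ = suc l , ≤-refl , ≮⇒≥ y≮ , y<u
  ... | yes y< with locate l y u≤y y<
  ...   | j , j≤l , a , b = j , m≤n⇒m≤1+n j≤l , a , b

  abstract
    -- Only values with `i < j` matter: these are the cases in which stage `j` has locked `d i`.
    ramsey : ∃ λ c → ∃ λ K → Infinite K ×
             (∀ i j → i < j → K i ≡ true → K j ≡ true → t j (d i) ≡ c)
    ramsey = Ramsey.homogeneous (λ i j → t j (d i))

  c : Bool
  c = proj₁ ramsey
  K : Subset
  K = proj₁ (proj₂ ramsey)
  K-inf : Infinite K
  K-inf = proj₁ (proj₂ (proj₂ ramsey))
  K-hom : ∀ i j → i < j → K i ≡ true → K j ≡ true → t j (d i) ≡ c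
  K-hom = proj₂ (proj₂ (proj₂ ramsey))

  elem : Bool → ℕ → ℕ
  elem false = d
  elem true = ρ

  Chosen : Bool → ℕ → Set
  Chosen τ x = ∃ λ i → K i ≡ true × elem τ i ≡ x

  A* : Reservoir
  A* τ x = truth (Chosen τ x)

  A*-chosen : ∀ {τ x} → A* τ x ≡ true → Chosen τ x
  A*-chosen = truth-sound

  elem-≥κ : ∀ τ i → κ i ≤ elem τ i
  elem-≥κ false i = ≤-trans (κ≤ρ i) (<⇒≤ (ρ<d i))
  elem-≥κ true i = κ≤ρ i

  elem-≥m : ∀ τ i → m i ≤ elem τ i
  elem-≥m false i = ≤-trans (m≤ρ i) (<⇒≤ (ρ<d i))
  elem-≥m true i = m≤ρ i

  elem-<κ : ∀ τ i → elem τ i < κ (suc i)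
  elem-<κ false i = d<κ i
  elem-<κ true i = <-trans (ρ<d i) (d<κ i)

  elem-index : ∀ {τ i j} → κ j ≤ elem τ i → elem τ i < κ (suc j) → i ≡ j
  elem-index {τ} {i} {j} lo hi = ≤-antisym
    (≮⇒≥ λ j<i → <⇒≱ hi (≤-trans (κ-mono j<i) (elem-≥κ τ i)))
    (≮⇒≥ λ i<j → <⇒≱ (elem-<κ τ i) (≤-trans (κ-mono i<j) lo))

  elem-∈A : ∀ τ i → A i τ (elem τ i) ≡ true
  elem-∈A false i = A⊆A i false _ (d∈A i)
  elem-∈A true i = ρ∈A i

  A*-inf : AllInfinite A*
  A*-inf τ n with K-inf n
  ... | k , n≤k , k∈K = elem τ k , ≤-trans n≤k (≤-trans (m-≥ k) (elem-≥m τ k)) ,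
                        truth-complete (k , k∈K , refl)

  A*⊆A₀ : A* ⊆ A₀
  A*⊆A₀ τ x x∈ with A*-chosen {τ} x∈
  ... | i , _ , refl = A⊆A₀ i τ _ (elem-∈A τ i)

  small-index : ∀ {τ i l b} → b ≤ m l → elem τ i < b → i < l
  small-index {τ} {i} {l} b≤m lt =
    ≰⇒> λ l≤i → <⇒≱ lt (≤-trans b≤m (≤-trans (m-mono l≤i) (elem-≥m τ i)))

  -- The bound is raised to `ρ l` because from there on `q l` locks every `d i` with `i < l`.
  closed : ℕ → Stem → Stem
  closed l s = stem (restrict s) (ρ l)

  closed-Ext : ∀ {l s} → bound s ≤ m l → Ext A* s (closed l s)
  closed-Ext {l} {s} b≤m = restrict-Ext s (ρ l) (≤-trans b≤m (m≤ρ l))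

  restrict-true : ∀ s τ x → restrict s τ x ≡ true → x < bound s × members s τ x ≡ true
  restrict-true s τ x x∈ with x <? bound s
  ... | yes x<b = x<b , trans (sym (if-true (<ᵇ-true x<b))) x∈
  ... | no x≮b = ⊥-elim (false≢true (restrict-empty s τ x (≮⇒≥ x≮b)) x∈)

  -- Old elements of L are covered by the validity of `s`. A new one is `d i` with `i < l`: against
  -- numbers from `ρ l` on it is locked by stage `l`, and against some `ρ j` in R with `i < j < l`
  -- the colour was computed and frozen at stage `j`. Homogeneity of `K` makes both colours `c`.
  closed-valid : ∀ {s s′ l} → Valid c q₀ s → Ext A* s s′ → K l ≡ true → bound s′ ≤ m l →
                 Valid c (q l) (closed l s′)
  closed-valid {s} {s′} {l} v e l∈K b≤m x y x<ρ x∈ x<y r f fe φ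
    with restrict-true s′ false x x∈
  ... | x<b′ , x∈s′ with x <? bound s
  ...   | yes x<b = v x y x<b (trans (sym (same e false x x<b)) x∈s′) x<y (old r) f
                      (extends-⊑ (q⊑q₀ l) fe) φ
    where
    old : ρ l ≤ y ⊎ restrict s′ true y ≡ true → bound s ≤ y ⊎ members s true y ≡ true
    old r with y <? bound s
    ... | no y≮b = inj₁ (≮⇒≥ y≮b)
    old (inj₁ ρ≤y) | yes y<b =
      ⊥-elim (<⇒≱ (<-≤-trans y<b (≤-trans (longer e) (≤-trans b≤m (m≤ρ l)))) ρ≤y)
    old (inj₂ y∈) | yes y<b =
      inj₂ (trans (sym (same e true y y<b)) (proj₂ (restrict-true s′ true y y∈)))
  ...   | no x≮b with A*-chosen {false} (new e false x (≮⇒≥ x≮b) x<b′ x∈s′)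
  ...     | i , i∈K , refl = fresh r
    where
    i<l : i < l
    i<l = small-index {false} b≤m x<b′
    fresh : ρ l ≤ y ⊎ restrict s′ true y ≡ true → ⊥
    fresh (inj₁ ρ≤y) = locks l (d i) (d∈ds i<l) f fe y ρ≤y
      (subst (λ b → Φ f (d i) y (not b)) (sym (K-hom i l i<l i∈K l∈K)) φ)
    fresh (inj₂ y∈) with restrict-true s′ true y y∈
    ... | y<b′ , y∈s′ with A*-chosen {true} (new e true y (≤-trans (≮⇒≥ x≮b) (<⇒≤ x<y)) y<b′ y∈s′)
    ...   | j , j∈K , refl = not-fixed (Φ-det φ
        (subst (Φ f (d i) (ρ j)) (K-hom i j i<j i∈K j∈K)
               (settled i<j (small-index {true} b≤m y<b′) fe)))
      where
      i<j : i < j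
      i<j = ≰⇒> λ j≤i → <⇒≱ x<y (case j≤i)
        where
        case : j ≤ i → ρ j ≤ d i
        case j≤i with m≤n⇒m<n∨m≡n j≤i
        ... | inj₂ refl = <⇒≤ (ρ<d j)
        ... | inj₁ j<i = <⇒≤ (<-≤-trans (elem-<κ true j) (≤-trans (κ-mono j<i) (elem-≥κ false i)))

  -- Since the stages keep all variants, the right one is found by reading from `s` whether it
  -- contains `ρ j` and `d j`; nothing else in `A*` lies between `κ j` and `κ (suc j)`.
  tracked : ∀ {s l} → Ext A* (base c) s → bound s ≡ ρ l → ∀ j → j ≤ l →
            ∃ λ S → (c , S) ∈ stems j × (∀ τ x → x < κ j → members s τ x ≡ S τ x)
  tracked {s} {l} e b≡ zero j≤l = restrict (base c) ,
      subst (λ st → (c , restrict (base c)) ∈ Stage.stems st) (sym stage-zero) (initial c) , agree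
    where
    initial : ∀ c → (c , restrict (base c)) ∈ Stage.stems start
    initial true = here refl
    initial false = there (here refl)
    κ0≤ρ : κ 0 ≤ ρ l
    κ0≤ρ = ≤-trans (κ-mono j≤l) (κ≤ρ l)
    agree : ∀ τ x → x < κ 0 → members s τ x ≡ restrict (base c) τ x
    agree τ x x<κ with x <? bound (base c)
    ... | yes x<b = trans (same e τ x x<b) (sym (if-true (<ᵇ-true x<b)))
    ... | no x≮b with members s τ x in x∈
    ...   | false = sym (restrict-empty (base c) τ x (≮⇒≥ x≮b))
    ...   | true with A*-chosen {τ} (new e τ x (≮⇒≥ x≮b)
                        (subst (x <_) (sym b≡) (<-≤-trans x<κ κ0≤ρ)) x∈)
    ...     | i , _ , refl = ⊥-elim (<⇒≱ x<κ (≤-trans (κ-mono z≤n) (elem-≥κ τ i)))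
  tracked {s} {l} e b≡ (suc j) j<l with tracked e b≡ j (<⇒≤ j<l)
  ... | S , S∈ , agree = proj₂ (variant (ρ j) (d j) (c , S) bs) , stems-suc j c S S∈ bs , agree′
    where
    bs : Bool × Bool
    bs = members s true (ρ j) , members s false (d j)
    S₁ : Reservoir
    S₁ = put S true (ρ j) (members s true (ρ j))
    miss : ∀ τ x → x < κ (suc j) → x ≢ elem τ j → members s τ x ≡ S τ x
    miss τ x x<κ x≢ with x <? κ j
    ... | yes x<κj = agree τ x x<κj
    ... | no x≮κj with members s τ x in x∈
    ...   | false = sym (stems-empty j c S S∈ τ x (≮⇒≥ x≮κj))
    ...   | true with A*-chosen {τ} (new e τ x (≤-trans base≤κ (≮⇒≥ x≮κj))
                        (subst (x <_) (sym b≡) (<-≤-trans x<κ (≤-trans (κ-mono j<l) (κ≤ρ l)))) x∈)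
      where
      base≤κ : bound (base c) ≤ κ j
      base≤κ = longer (stems-Ext j c S S∈)
    ...     | i , _ , refl with elem-index {τ} {i} {j} (≮⇒≥ x≮κj) x<κ
    ...       | refl = ⊥-elim (x≢ refl)
    agree′ : ∀ τ x → x < κ (suc j) → members s τ x ≡ put S₁ false (d j) (members s false (d j)) τ x
    agree′ false x x<κ with x ≟ d j
    ... | yes refl = sym (put-hit S₁ false (d j) _)
    ... | no x≢ = trans (miss false x x<κ x≢) (sym (trans
          (put-miss S₁ false (d j) _ false x (inj₂ x≢)) (put-miss S true (ρ j) _ false x (inj₁ λ ()))))
    agree′ true x x<κ with x ≟ ρ j
    ... | yes refl = sym (trans (put-miss S₁ false (d j) _ true x (inj₁ λ ()))
                                (put-hit S true (ρ j) _))
    ... | no x≢ = trans (miss true x x<κ x≢) (sym (trans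
          (put-miss S₁ false (d j) _ true x (inj₁ λ ())) (put-miss S true (ρ j) _ true x (inj₂ x≢))))

  -- Otherwise `y` lies between `m j` and `u (suc j)` for some `j < l`. Below `u (suc j)` the stem
  -- `s` is one recorded at stage `j`, possibly with `ρ j`, because `d j` comes later; the rest of
  -- `s` is drawn from `A (suc j)`, where `y` has been denied.
  output-in-gap : ∀ {s l} → Ext A* (base c) s → bound s ≡ ρ l → Valid c (q l) s →
    ∀ τ y → Out (γ c) s τ y → u 0 ≤ y → y < m l → ∃ λ j → j ≤ l × u j ≤ y × y < m j
  output-in-gap {s} {l} e b≡ v τ y o u≤y y<m
    with locate l y u≤y (<-trans (<-≤-trans y<m (m≤ρ l)) (ρ<u l))
  ... | j , j≤l , uj≤y , y<u with y <? m j
  ...   | yes y<mj = j , j≤l , uj≤y , y<mj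
  ...   | no y≮mj with m≤n⇒m<n∨m≡n j≤l
  ...     | inj₂ refl = ⊥-elim (y≮mj y<m)
  ...     | inj₁ j<l with tracked e b≡ j j≤l
  ...       | S , S∈ , agree = ⊥-elim (denied j c S S∈ real b τ y (≮⇒≥ y≮mj) y<u s e′ o)
    where
    b : Bool
    b = members s true (ρ j)
    κ≤b : ∀ {i} → i ≤ l → κ i ≤ bound s
    κ≤b i≤l = ≤-trans (κ-mono i≤l) (≤-trans (κ≤ρ l) (≤-reflexive (sym b≡)))
    S⊆s : ∀ σ x → S σ x ≡ true → members s σ x ≡ true
    S⊆s σ x x∈ with x <? κ j
    ... | yes x<κ = trans (agree σ x x<κ) x∈
    ... | no x≮κ = ⊥-elim (false≢true (stems-empty j c S S∈ σ x (≮⇒≥ x≮κ)) x∈)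
    real : Realizable (κ j) c S
    -- The later condition `q l` is the witness: with its bound raised to that of `s`, the stem `S`
    -- has no members outside `s` and inherits its validity.
    real = bound s , κ≤b j≤l , q l , q⊑q₀ l , λ x z x<b x∈ x<z r →
      v x z x<b (S⊆s false x x∈) x<z (map₂ (S⊆s true z) r)
    chosen : ∀ σ x → κ j ≤ x → x < bound s → members s σ x ≡ true → Chosen σ x
    chosen σ x κ≤x x<b x∈ =
      A*-chosen {σ} (new e σ x (≤-trans (longer (stems-Ext j c S S∈)) κ≤x) x<b x∈)
    u≤b : u (suc j) ≤ bound s
    u≤b = ≤-trans (u≤κ (suc j)) (κ≤b j<l)
    miss : ∀ σ x → x < u (suc j) → σ ≢ true ⊎ x ≢ ρ j → members s σ x ≡ S σ x
    miss σ x x<u σx with x <? κ j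
    ... | yes x<κ = agree σ x x<κ
    ... | no x≮κ with members s σ x in x∈
    ...   | false = sym (stems-empty j c S S∈ σ x (≮⇒≥ x≮κ))
    ...   | true with chosen σ x (≮⇒≥ x≮κ) (<-≤-trans x<u u≤b) x∈
    ...     | i , _ , refl with elem-index {σ} {i} {j} (≮⇒≥ x≮κ) (<-≤-trans x<u (u≤κ (suc j)))
    miss true x x<u (inj₁ σ≢) | no _ | true | i , _ , refl | refl = ⊥-elim (σ≢ refl)
    miss true x x<u (inj₂ x≢) | no _ | true | i , _ , refl | refl = ⊥-elim (x≢ refl)
    miss false x x<u _ | no _ | true | i , _ , refl | refl = ⊥-elim (<⇒≱ x<u (u≤d j))
    agree′ : ∀ σ x → x < u (suc j) → members s σ x ≡ put S true (ρ j) b σ x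
    agree′ false x x<u =
      trans (miss false x x<u (inj₁ λ ())) (sym (put-miss S true (ρ j) b false x (inj₁ λ ())))
    agree′ true x x<u with x ≟ ρ j
    ... | yes refl = sym (put-hit S true (ρ j) b)
    ... | no x≢ = trans (miss true x x<u (inj₂ x≢)) (sym (put-miss S true (ρ j) b true x (inj₂ x≢)))
    later : ∀ σ i → u (suc j) ≤ elem σ i → A (suc j) σ (elem σ i) ≡ true
    later false i u≤ = A-antitone (s≤s (≮⇒≥ λ i<j → <⇒≱
      (<-≤-trans (elem-<κ false i) (≤-trans (κ-mono i<j) (≤-trans (κ≤ρ j) (<⇒≤ (ρ<u j))))) u≤))
      false (d i) (d∈A i)
    later true i u≤ =
      A-antitone (≰⇒> λ i≤j → <⇒≱ (<-≤-trans (ρ<u i) (u-mono (s≤s i≤j))) u≤) true (ρ i) (ρ∈A i)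
    nw : ∀ σ x → u (suc j) ≤ x → x < bound s → members s σ x ≡ true → A (suc j) σ x ≡ true
    nw σ x u≤x x<b x∈ with chosen σ x (≤-trans (κ≤ρ j) (≤-trans (<⇒≤ (ρ<u j)) u≤x)) x<b x∈
    ... | i , _ , refl = later σ i u≤x
    e′ : Ext (A (suc j)) (stem (put S true (ρ j) b) (u (suc j))) s
    e′ = ext u≤b agree′ nw

-- Defeating one of two functionals

col-< : ∀ f {x y} → x < y → col f x y ≡ f x y
col-< f x<y = if-true (<ᵇ-true x<y)

col-> : ∀ f {x y} → y < x → col f x y ≡ f y x
col-> f y<x = if-false (<ᵇ-false (<⇒≤ y<x))

-- The opposite side is infinite and so meets the row of `w` beyond any point. Homogeneity in both
-- orders makes this work for `w` on the right side as well.
phom-colour : ∀ {f} {P : Reservoir} (ph : PHom f (P false) (P true)) → ∀ τ w v M →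
              P τ w ≡ true → (∀ y → M ≤ y → f w y ≡ v) → proj₁ (proj₂ (proj₂ ph)) ≡ v
phom-colour {f} (_ , infR , k , hom) false w v M w∈ lim with infR (M ⊔ suc w)
... | y , ≤y , y∈ = trans (sym (hom w y w∈ y∈ (<⇒≢ w<y)))
                      (trans (col-< f w<y) (lim y (≤-trans (m≤m⊔n M (suc w)) ≤y)))
  where
  w<y : w < y
  w<y = ≤-trans (m≤n⊔m M (suc w)) ≤y
phom-colour {f} (infL , _ , k , hom) true w v M w∈ lim with infL (M ⊔ suc w)
... | y , ≤y , y∈ = trans (sym (hom y w y∈ w∈ (λ y≡w → <⇒≢ w<y (sym y≡w))))
                      (trans (col-> f w<y) (lim y (≤-trans (m≤m⊔n M (suc w)) ≤y)))
  where
  w<y : w < y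
  w<y = ≤-trans (m≤n⊔m M (suc w)) ≤y

-- Stands in for Γ_c on a side whose outputs need not be controlled.
silent : Functional
silent _ _ _ = ⊥

module Meeting (em : ExcludedMiddle 0ℓ) (Φ : Coloring → ℕ → ℕ → Bool → Set)
               (Φ-det : ∀ {f d u b b′} → Φ f d u b → Φ f d u b′ → b ≡ b′)
               (Φ-use : ∀ {f d u b} → Φ f d u b →
                        ∃ λ k → ∀ f′ → AgreePairs k f f′ → Φ f′ d u b)
               {I : Set} (fn : I → Functional) where
  open Classical em
  open Forcing em Φ Φ-det Φ-use
  open Stages em Φ Φ-det Φ-use

  Goal : Set
  Goal = ℕ ⊎ I

  Achieved : Goal → Condition → Stem → Reservoir → Set
  Achieved (inj₁ b) q s A = ∃ λ x → b ≤ x × x < bound s × members s false x ≡ true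
  Achieved (inj₂ i) q s A = (∃ λ b → Dead (fn i) s A b) ⊎ Bad (fn i) q s

  record Reachable (c : Bool) (q : Condition) (A : Reservoir) (s : Stem) (g : Goal) : Set where
    constructor reach
    field
      {q′} : Condition
      {A′} : Reservoir
      {s′} : Stem
      q′⊑q : q′ ⊑ q
      A′⊆A : A′ ⊆ A
      A′-inf : AllInfinite A′
      extension : Ext A s s′
      valid : Valid c q′ s′
      achieved : Achieved g q′ s′ A′

  Reachable-mono : ∀ {c q q′ A A′ s s′ g} → q′ ⊑ q → A′ ⊆ A → Ext A s s′ →
                   Reachable c q′ A′ s′ g → Reachable c q A s g
  Reachable-mono q′⊑q A′⊆A e (reach a b i e′ v d) =
    reach (⊑-trans a q′⊑q) (⊆-trans b A′⊆A) i (Ext-trans e (Ext-⊆ A′⊆A e′)) v d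

  Active : Functional → Stem → Reservoir → Set
  Active γ s A = ∀ m → ∃ λ s′ → ROnly A s s′ × ∃ λ A′ → A′ ⊆ A × AllInfinite A′ ×
                 ∃ λ τ → ∃ λ w → m ≤ w × Undeniable γ s′ A′ τ w

  AlwaysActive : Functional → Stem → Reservoir → Set
  AlwaysActive γ s A = ∀ A′ → A′ ⊆ A → AllInfinite A′ → Active γ s A′

  Undeniable-⊆ : ∀ {γ s A A′ τ w} → A′ ⊆ A → Undeniable γ s A τ w → Undeniable γ s A′ τ w
  Undeniable-⊆ A′⊆A und A″ A″⊆A′ inf = und A″ (⊆-trans A″⊆A′ A′⊆A) inf

  Inactive-mono : ∀ {γ c q q′ A A′ s} → q′ ⊑ q → A′ ⊆ A → Inactive γ c q A s → Inactive γ c q′ A′ s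
  Inactive-mono q′⊑q A′⊆A h q″ q″⊑ B B⊆ inf s′ e v =
    h q″ (⊑-trans q″⊑ q′⊑q) B (⊆-trans B⊆ A′⊆A) inf s′ (Ext-⊆ A′⊆A e) v

  silent-Inactive : ∀ {c q A s} → Inactive silent c q A s
  silent-Inactive q′ _ A′ _ inf s′ _ _ = A′ , (λ _ _ a → a) , inf , 0 ,
    λ s″ _ A₃ _ inf₃ τ w _ und → let (s₄ , _ , o) = und A₃ (λ _ _ a → a) inf₃ in
      o (members s₄) (λ _ _ _ → refl)

  ROnly-valid : ∀ {c q A s s′} → Valid c q s → ROnly A s s′ → Valid c q s′
  ROnly-valid {s = s} {s′} v ro x y x<b′ x∈ x<y r f fe with x <? bound s
  ... | no x≮b = ⊥-elim (false≢true (none ro x (≮⇒≥ x≮b) x<b′) x∈)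
  ... | yes x<b = v x y x<b (trans (sym (same e false x x<b)) x∈) x<y (old r) f fe
    where
    e = ROnly.extension ro
    old : bound s′ ≤ y ⊎ members s′ true y ≡ true → bound s ≤ y ⊎ members s true y ≡ true
    old (inj₁ b′≤y) = inj₁ (≤-trans (longer e) b′≤y)
    old (inj₂ y∈) with y <? bound s
    ... | yes y<b = inj₂ (trans (sym (same e true y y<b)) y∈)
    ... | no y≮b = inj₁ (≮⇒≥ y≮b)

  -- Here `active` names no promised number yet: it has to lie beyond all rows of the final
  -- condition, and classifying the other colour may still add rows. `activate` chooses it later
  -- without changing the condition.
  data PreStatus (c : Bool) (q : Condition) (A : Reservoir) : Set where
    waiting : ∀ b s → Valid c q s → ¬ Reachable c q A s (inj₁ b) → PreStatus c q A
    inactive : ∀ i s → Valid c q s → ¬ Reachable c q A s (inj₂ i) →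
               Inactive (fn i) c q A s → PreStatus c q A
    active : ∀ i s → Valid c q s → ¬ Reachable c q A s (inj₂ i) →
             AlwaysActive (fn i) s A → PreStatus c q A

  data Status (c : Bool) (q : Condition) (A : Reservoir) : Set where
    waiting : ∀ b s → Valid c q s → ¬ Reachable c q A s (inj₁ b) → Status c q A
    inactive : ∀ i s → Valid c q s → ¬ Reachable c q A s (inj₂ i) →
               Inactive (fn i) c q A s → Status c q A
    active : ∀ i s → Valid c q s → ¬ Reachable c q A s (inj₂ i) →
             ∀ τ w → rows q ≤ w → Undeniable (fn i) s A τ w → Status c q A

  PreStatus-mono : ∀ {c q q′ A A′} → q′ ⊑ q → A′ ⊆ A → PreStatus c q A → PreStatus c q′ A′
  PreStatus-mono q′⊑ A′⊆ (waiting b s v ¬r) =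
    waiting b s (Valid-⊑ {s = s} q′⊑ v) (λ r → ¬r (Reachable-mono q′⊑ A′⊆ Ext-refl r))
  PreStatus-mono q′⊑ A′⊆ (inactive i s v ¬r h) =
    inactive i s (Valid-⊑ {s = s} q′⊑ v) (λ r → ¬r (Reachable-mono q′⊑ A′⊆ Ext-refl r))
      (Inactive-mono q′⊑ A′⊆ h)
  PreStatus-mono q′⊑ A′⊆ (active i s v ¬r h) =
    active i s (Valid-⊑ {s = s} q′⊑ v) (λ r → ¬r (Reachable-mono q′⊑ A′⊆ Ext-refl r))
      (λ B B⊆ → h B (⊆-trans B⊆ A′⊆))

  Status-⊆ : ∀ {c q A A′} → A′ ⊆ A → Status c q A → Status c q A′
  Status-⊆ A′⊆ (waiting b s v ¬r) =
    waiting b s v (λ r → ¬r (Reachable-mono ⊑-refl A′⊆ Ext-refl r))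
  Status-⊆ A′⊆ (inactive i s v ¬r h) =
    inactive i s v (λ r → ¬r (Reachable-mono ⊑-refl A′⊆ Ext-refl r)) (Inactive-mono ⊑-refl A′⊆ h)
  Status-⊆ A′⊆ (active i s v ¬r τ w n≤w und) =
    active i s v (λ r → ¬r (Reachable-mono ⊑-refl A′⊆ Ext-refl r)) τ w n≤w (Undeniable-⊆ {fn i} A′⊆ und)

  -- If no stronger condition and thinner reservoir give a valid extension that is always active,
  -- then every valid extension has a thinning on which activity fails, and this is inactivity.
  classify : ∀ c q A s g → AllInfinite A → Valid c q s → ¬ Reachable c q A s g →
             ∃ λ q′ → q′ ⊑ q × ∃ λ A′ → A′ ⊆ A × AllInfinite A′ × PreStatus c q′ A′
  classify c q A s (inj₁ b) inf v ¬r = q , ⊑-refl , A , (λ _ _ a → a) , inf , waiting b s v ¬r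
  classify c q A s (inj₂ i) inf v ¬r
    with em {∃ λ q′ → q′ ⊑ q × ∃ λ A′ → A′ ⊆ A × AllInfinite A′ ×
             ∃ λ s′ → Ext A s s′ × Valid c q′ s′ × AlwaysActive (fn i) s′ A′}
  ... | yes (q′ , q′⊑ , A′ , A′⊆ , inf′ , s′ , e , v′ , h) = q′ , q′⊑ , A′ , A′⊆ , inf′ ,
    active i s′ v′ (λ r → ¬r (Reachable-mono q′⊑ A′⊆ e r)) h
  ... | no never = q , ⊑-refl , A , (λ _ _ a → a) , inf , inactive i s v ¬r inact
    where
    inact : Inactive (fn i) c q A s
    inact q′ q′⊑ A′ A′⊆ inf′ s′ e v′
      with ¬∀⇒∃¬ (λ h → never (q′ , q′⊑ , A′ , A′⊆ , inf′ , s′ , e , v′ , h))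
    ... | A″ , ¬h with ¬∀⇒∃¬ ¬h
    ... | A″⊆ , ¬h′ with ¬∀⇒∃¬ ¬h′
    ... | inf″ , ¬act with ¬∀⇒∃¬ ¬act
    ... | m , none′ = A″ , A″⊆ , inf″ , m , λ s″ ro A₃ A₃⊆ inf₃ τ w m≤w und →
      none′ (s″ , ro , A₃ , A₃⊆ , inf₃ , τ , w , m≤w , und)

  activate : ∀ {c q A} → AllInfinite A → PreStatus c q A →
             ∃ λ A′ → A′ ⊆ A × AllInfinite A′ × Status c q A′
  activate inf (waiting b s v ¬r) = _ , (λ _ _ a → a) , inf , waiting b s v ¬r
  activate inf (inactive i s v ¬r h) = _ , (λ _ _ a → a) , inf , inactive i s v ¬r h
  activate {c} {q} {A} inf (active i s v ¬r h) with h A (λ _ _ a → a) inf (rows q)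
  ... | s′ , ro , A′ , A′⊆ , inf′ , τ , w , n≤w , und = A′ , A′⊆ , inf′ ,
    active i s′ (ROnly-valid {c} {q} {s = s} {s′} v ro)
      (λ r → ¬r (Reachable-mono ⊑-refl A′⊆ (ROnly.extension ro) r)) τ w n≤w und

  module _ {c : Bool} {q : Condition} {A : Reservoir} where

    functional : Status c q A → Functional
    functional (waiting _ _ _ _) = silent
    functional (inactive i _ _ _ _) = fn i
    functional (active _ _ _ _ _ _ _ _) = silent

    stem-of : Status c q A → Stem
    stem-of (waiting _ s _ _) = s
    stem-of (inactive _ s _ _ _) = s
    stem-of (active _ s _ _ _ _ _ _) = s

    inactivity : (σ : Status c q A) → Inactive (functional σ) c q A (stem-of σ)
    inactivity (waiting _ s _ _) = silent-Inactive {s = s}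
    inactivity (inactive _ _ _ _ h) = h
    inactivity (active _ s _ _ _ _ _ _) = silent-Inactive {s = s}

    Marks : Status c q A → ℕ → Set
    Marks (waiting _ _ _ _) _ = ⊥
    Marks (inactive _ _ _ _ _) _ = ⊥
    Marks (active _ _ _ _ _ w _ _) x = x ≡ w

    mark-bound : Status c q A → ℕ
    mark-bound (waiting _ _ _ _) = 0
    mark-bound (inactive _ _ _ _ _) = 0
    mark-bound (active _ _ _ _ _ w _ _) = suc w

    mark-≥ : ∀ σ x → Marks σ x → rows q ≤ x
    mark-≥ (active _ _ _ _ _ _ n≤w _) x refl = n≤w

    mark-< : ∀ σ x → Marks σ x → x < mark-bound σ
    mark-< (active _ _ _ _ _ w _ _) x refl = n<1+n w

  module Contradiction {q₀ : Condition} {A₀ : Reservoir} (good : Good q₀) (inf : AllInfinite A₀)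
                       (σ : ∀ c → Status c q₀ A₀) where

    Marked : ℕ → Set
    Marked x = ∃ λ c → Marks (σ c) x

    wb : ℕ
    wb = mark-bound (σ true) ⊔ mark-bound (σ false)

    abstract
      marks : Subset
      marks x = truth (Marked x)

      marked⇒marks : ∀ {x} → Marked x → marks x ≡ true
      marked⇒marks = truth-complete

      marked-≥ : ∀ x → marks x ≡ true → rows q₀ ≤ x
      marked-≥ x Wx = let (c , mk) = truth-sound {Marked x} Wx in mark-≥ (σ c) x mk

      marked-< : ∀ x → marks x ≡ true → x < wb
      marked-< x Wx with truth-sound {Marked x} Wx
      ... | true , mk = <-≤-trans (mark-< (σ true) x mk) (m≤m⊔n _ _)
      ... | false , mk = <-≤-trans (mark-< (σ false) x mk) (m≤n⊔m (mark-bound (σ true)) _)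

    open Sequence q₀ good marks wb marked-≥ marked-< A₀ inf
           (λ c → functional (σ c)) (λ c → stem-of (σ c)) (λ c → inactivity (σ c))
    open At

    unmarked : ∀ x → wb ≤ x → marks x ≡ false
    unmarked x wb≤x with marks x in Wx
    ... | false = refl
    ... | true = ⊥-elim (<⇒≱ (marked-< x Wx) wb≤x)

    close : ∀ s → Valid c q₀ s → ∀ s′ → Ext A* s s′ → ∀ B →
            ∃ λ l → B ≤ m l × bound s′ ≤ m l × Valid c (q l) (closed l s′)
    close s v s′ e B with K-inf (B ⊔ bound s′)
    ... | l , ≤l , l∈K = l , ≤-trans (≤-trans (m≤m⊔n B _) ≤l) (m-≥ l) , b≤m ,
                         closed-valid {s} v e l∈K b≤m
      where
      b≤m : bound s′ ≤ m l
      b≤m = ≤-trans (≤-trans (m≤n⊔m B _) ≤l) (m-≥ l)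

    limit-true : ∀ {l f} → f extends q l → ∀ x → u 0 ≤ x → x < m l → ∀ y → m l ≤ y → f x y ≡ true
    limit-true {l} fe x u≤x x<m y m≤y = trans (fe x (<-≤-trans x<m (m≤rows l)) y)
      (q-lim l x y (≤-trans (rows≤u 0) u≤x) x<m (unmarked x (≤-trans (wb≤u 0) u≤x)) m≤y)

    ¬waiting : ∀ b s → Valid c q₀ s → ¬ Reachable c q₀ A₀ s (inj₁ b) → ⊥
    ¬waiting b s v ¬r = ¬r (reach (q⊑q₀ l) (λ _ _ a → a) inf
        (Ext-⊆ A*⊆A₀ (Ext-trans e (closed-Ext {s = s′} b≤m))) (proj₂ (proj₂ (proj₂ closing)))
        (x , ≤-trans (m≤m⊔n b _) ≤x , ≤-trans b≤m (m≤ρ l) ,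
         trans (if-true (<ᵇ-true (n<1+n x))) (put-hit (restrict s) false x true)))
      where
      picked : ∃ λ x → b ⊔ bound s ≤ x × A* false x ≡ true
      picked = A*-inf false (b ⊔ bound s)
      x = proj₁ picked
      ≤x = proj₁ (proj₂ picked)
      s′ : Stem
      s′ = stem (put (restrict s) false x true) (suc x)
      e : Ext A* s s′
      e = Ext-trans (restrict-Ext s (bound s) ≤-refl)
            (put-Ext (restrict-empty s) ≤-refl (≤-trans (m≤n⊔m b _) ≤x) (proj₂ (proj₂ picked)))
      closing = close s v s′ e 0
      l = proj₁ closing
      b≤m = proj₁ (proj₂ (proj₂ closing))

    -- Were there no such pair, `Dead` would hold with reservoir `A*` and the goal would be reached.
    pair-out : ∀ {i s s′ q′} → q′ ⊑ q₀ → Ext A* s s′ → Valid c q′ s′ → ∀ b →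
               ¬ Reachable c q₀ A₀ s (inj₂ i) → ∃ λ s″ → Ext A* s′ s″ × PairOut (fn i) s″ b
    pair-out q′⊑ e v b ¬r = dne λ none → ¬r (reach q′⊑ A*⊆A₀ A*-inf (Ext-⊆ A*⊆A₀ e) v
      (inj₁ (b , λ s″ e′ po → none (s″ , e′ , po))))

    ¬active : ∀ i s → Valid c q₀ s → ¬ Reachable c q₀ A₀ s (inj₂ i) → ∀ τ w → Marked w →
              Undeniable (fn i) s A₀ τ w → ⊥
    ¬active i s v ¬r τ w mk und = from-output (und A* A*⊆A₀ A*-inf)
      where
      w<rows : ∀ l → w < rows (q l)
      w<rows l = <-≤-trans (marked-< w (marked⇒marks mk))
        (≤-trans (≤-trans (wb≤u l) (u≤m l)) (m≤rows l))

      from-pair : ∀ {s₁ s₂} → Ext A* s s₁ → Out (fn i) s₁ τ w → Ext A* s₁ s₂ →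
                  PairOut (fn i) s₂ (u 0) → ⊥
      from-pair {s₁} {s₂} e₁ w-out e₂ (x , _ , _ , u≤x , _ , x-out , _) =
        ¬r (reach (q⊑q₀ l) (λ _ _ a → a) inf (Ext-⊆ A*⊆A₀ (Ext-trans (Ext-trans e₁ e₂) e₃))
              (proj₂ (proj₂ (proj₂ closing))) (inj₂ bad))
        where
        closing = close s v s₂ (Ext-trans e₁ e₂) (suc x)
        l = proj₁ closing
        e₃ : Ext A* s₂ (closed l s₂)
        e₃ = closed-Ext {s = s₂} (proj₁ (proj₂ (proj₂ closing)))
        bad : Bad (fn i) (q l) (closed l s₂)
        bad f fe P P⊇ ph = false≢true refl
          (trans (sym (phom-colour {f} {P} ph τ w false 0
            (P⊇ τ w (Out-Ext {fn i} (Ext-trans e₂ e₃) w-out))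
            (λ y _ → trans (fe w (w<rows l) y) (q-W l w y (marked⇒marks mk)))))
            (phom-colour {f} {P} ph false x true (m l)
              (P⊇ false x (Out-Ext {fn i} e₃ x-out))
              (limit-true fe x u≤x (proj₁ (proj₂ closing)))))

      from-output : (∃ λ s′ → Ext A* s s′ × Out (fn i) s′ τ w) → ⊥
      from-output (s₁ , e₁ , w-out) =
        -- The stem that outputs `w` is closed before a pair is requested, since excluding `Dead`
        -- takes a valid stem.
        let (s₂ , e₂ , po) = pair-out {i} (q⊑q₀ l) (Ext-trans e₁ e₁′) valid₁ (u 0) ¬r
        in from-pair e₁ w-out (Ext-trans e₁′ e₂) po
        where
        closing = close s v s₁ e₁ 0
        l = proj₁ closing
        valid₁ = proj₂ (proj₂ (proj₂ closing))
        e₁′ : Ext A* s₁ (closed l s₁)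
        e₁′ = closed-Ext {s = s₁} (proj₁ (proj₂ (proj₂ closing)))

    -- The smaller of `x` and `y` has a row with limit 1, which fixes the colour, while the larger
    -- lies where that row is 0. If `y < x`, the decisive row belongs to the right side, so both
    -- orders of p-homogeneity are exploited.
    ¬inactive : ∀ i s → Valid c q₀ s → ¬ Reachable c q₀ A₀ s (inj₂ i) →
                functional (σ c) ≡ fn i → stem-of (σ c) ≡ s → ⊥
    ¬inactive i s v ¬r eqγ eqs =
      let (s₁ , e₁ , po) = pair-out {i} ⊑-refl Ext-refl v (u 0) ¬r in from-pair e₁ po
      where
      from-pair : ∀ {s₁} → Ext A* s s₁ → PairOut (fn i) s₁ (u 0) → ⊥
      from-pair {s₁} e₁ (x , y , x≢y , u≤x , u≤y , x-out , y-out) =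
        ¬r (reach (q⊑q₀ l) (λ _ _ a → a) inf (Ext-⊆ A*⊆A₀ (Ext-trans e₁ e₂)) valid₁ (inj₂ bad))
        where
        closing = close s v s₁ e₁ (suc (x ⊔ y))
        l = proj₁ closing
        valid₁ = proj₂ (proj₂ (proj₂ closing))
        e₂ : Ext A* s₁ (closed l s₁)
        e₂ = closed-Ext {s = s₁} (proj₁ (proj₂ (proj₂ closing)))
        x<m : x < m l
        x<m = ≤-trans (s≤s (m≤m⊔n x y)) (proj₁ (proj₂ closing))
        y<m : y < m l
        y<m = ≤-trans (s≤s (m≤n⊔m x y)) (proj₁ (proj₂ closing))
        x-out′ : Out (fn i) (closed l s₁) false x
        x-out′ = Out-Ext {fn i} e₂ x-out
        y-out′ : Out (fn i) (closed l s₁) true y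
        y-out′ = Out-Ext {fn i} e₂ y-out
        -- The interval between m j and u (suc j) was denied, so outputs lie where the rows are false.
        off-limit : ∀ {f} → f extends q l → ∀ τ a b → Out (fn i) (closed l s₁) τ b → u 0 ≤ a →
                    a < b → b < m l → f a b ≡ false
        off-limit fe τ a b o u≤a a<b b<m =
          let (j , j≤l , uj≤b , b<mj) = output-in-gap {closed l s₁} {l}
                (subst (λ s → Ext A* s (closed l s₁)) (sym eqs) (Ext-trans e₁ e₂)) refl valid₁ τ b
                (subst (λ γ → Out γ (closed l s₁) τ b) (sym eqγ) o) (≤-trans u≤a (<⇒≤ a<b)) b<m
          in gap j≤l fe a b (≤-trans (rows≤u 0) u≤a) a<b (unmarked a (≤-trans (wb≤u 0) u≤a)) uj≤b b<mj
        bad : Bad (fn i) (q l) (closed l s₁)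
        bad f fe P P⊇ ph = absurd (<-cmp x y)
          where
          hom = proj₂ (proj₂ (proj₂ ph)) x y (P⊇ false x x-out′) (P⊇ true y y-out′) x≢y
          absurd : Tri (x < y) (x ≡ y) (y < x) → ⊥
          absurd (tri≈ _ x≡y _) = x≢y x≡y
          absurd (tri< x<y _ _) = false≢true (off-limit fe true x y y-out′ u≤x x<y y<m)
            (trans (sym (col-< f x<y)) (trans hom
              (phom-colour {f} {P} ph false x true (m l) (P⊇ false x x-out′) (limit-true fe x u≤x x<m))))
          absurd (tri> _ _ y<x) = false≢true (off-limit fe false y x x-out′ u≤y y<x x<m)
            (trans (sym (col-> f y<x)) (trans hom
              (phom-colour {f} {P} ph true y true (m l) (P⊇ true y y-out′) (limit-true fe y u≤y y<m))))

    contradiction : ⊥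
    contradiction = by-status (σ c) refl
      where
      by-status : (σ′ : Status c q₀ A₀) → σ c ≡ σ′ → ⊥
      by-status (waiting b s v ¬r) _ = ¬waiting b s v ¬r
      by-status (inactive i s v ¬r _) eq =
        ¬inactive i s v ¬r (cong functional eq) (cong stem-of eq)
      by-status (active i s v ¬r τ w n≤w und) eq =
        ¬active i s v ¬r τ w (c , subst (λ σ → Marks σ w) (sym eq) refl) und

  goal-reachable : ∀ {q A} → Good q → AllInfinite A → (s : Bool → Stem) (g : Bool → Goal) →
                   (∀ c → Valid c q (s c)) → ∃ λ c → Reachable c q A (s c) (g c)
  goal-reachable {q} {A} good inf s g v = dne λ none →
    let (q₁ , q₁⊑ , A₁ , A₁⊆ , inf₁ , p₁) =
          classify true q A (s true) (g true) inf (v true) (λ r → none (true , r))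
        (q₂ , q₂⊑ , A₂ , A₂⊆ , inf₂ , p₂) =
          classify false q₁ A₁ (s false) (g false) inf₁ (Valid-⊑ {s = s false} q₁⊑ (v false))
            (λ r → none (false , Reachable-mono q₁⊑ A₁⊆ Ext-refl r))
        (A₃ , A₃⊆ , inf₃ , σ₁) = activate inf₂ (PreStatus-mono q₂⊑ A₂⊆ p₁)
        (A₄ , A₄⊆ , inf₄ , σ₂) = activate inf₃ (PreStatus-mono ⊑-refl A₃⊆ p₂)
    in Contradiction.contradiction (good-⊑ (⊑-trans q₂⊑ q₁⊑) good) inf₄
         (λ { true → Status-⊆ A₄⊆ σ₁ ; false → σ₂ })
    where
    good-⊑ : ∀ {q q′} → q′ ⊑ q → Good q → Good q′
    good-⊑ q′⊑ good = record
      { total = λ q″ q″⊑ → total good q″ (⊑-trans q″⊑ q′⊑)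
      ; stable = λ q″ q″⊑ → stable good q″ (⊑-trans q″⊑ q′⊑) }

-- The generic coloring

bit-injective : ∀ {a b} → bit a ≡ bit b → a ≡ b
bit-injective {true} {true} _ = refl
bit-injective {false} {false} _ = refl

Computed : PR 1 → Coloring → ℕ → ℕ → Bool → Set
Computed e f d u b = Eval (enc f) e (pair d u ∷ []) (bit b)

computed-det : ∀ e {f d u b b′} → Computed e f d u b → Computed e f d u b′ → b ≡ b′
computed-det e φ φ′ = bit-injective (Eval-deterministic φ φ′)

computed-use : ∀ e {f d u b} → Computed e f d u b →
               ∃ λ k → ∀ f′ → AgreePairs k f f′ → Computed e f′ d u b
computed-use e φ = let (k , h) = use φ in k , λ f′ a → h (enc f′) (enc-agree a)

index : Bool → ℕ → ℕ
index false x = double x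
index true x = suc (double x)

join-index : ∀ (A : Reservoir) τ x → (A false ⊕ A true) (index τ x) ≡ A τ x
join-index A false x = join-even (A false) (A true) x
join-index A true x = join-odd (A false) (A true) x

-- Only answers 1 count as outputs, since `Dead` and `Bad` argue from elements that are put into the
-- sets.
evaluator : PR 1 → Functional
evaluator i A τ x = Eval (A false ⊕ A true) i (index τ x ∷ []) 1

module Construction (em : ExcludedMiddle 0ℓ) where
  open Classical em
  module F (e : PR 1) = Forcing em (Computed e) (λ {f} → computed-det e {f}) (λ {f} → computed-use e {f})
  module M (e : PR 1) = Meeting em (Computed e) (λ {f} → computed-det e {f}) (λ {f} → computed-use e {f}) evaluator

  Goal : Set
  Goal = ℕ ⊎ PR 1

  -- One side serves one program for the adversary. Both colours are pursued on a common reservoir,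
  -- as the successful colour emerges only from the whole construction.
  record Side : Set where
    field
      stems : Bool → Stem
      reservoir : Reservoir
      infinite : AllInfinite reservoir
  open Side

  record _≼ˢ_ (d′ d : Side) : Set where
    field
      thinner : reservoir d′ ⊆ reservoir d
      prolongs : ∀ c → Ext (reservoir d) (stems d c) (stems d′ c)
  open _≼ˢ_

  ≼ˢ-refl : ∀ {d} → d ≼ˢ d
  ≼ˢ-refl = record { thinner = λ _ _ a → a ; prolongs = λ _ → Ext-refl }

  ≼ˢ-trans : ∀ {a b c} → a ≼ˢ b → b ≼ˢ c → a ≼ˢ c
  ≼ˢ-trans p q = record
    { thinner = ⊆-trans (thinner p) (thinner q)
    ; prolongs = λ c → Ext-trans (prolongs q c) (Ext-⊆ (thinner q) (prolongs p c)) }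

  record State : Set where
    field
      cond : Condition
      side : PR 1 → Side
      valid : ∀ e c → F.Valid e c cond (stems (side e) c)
  open State

  record _≼_ (s′ s : State) : Set where
    field
      cond-⊑ : cond s′ ⊑ cond s
      side-≼ : ∀ e → side s′ e ≼ˢ side s e
  open _≼_

  ≼-refl : ∀ {s} → s ≼ s
  ≼-refl = record { cond-⊑ = ⊑-refl ; side-≼ = λ _ → ≼ˢ-refl }

  ≼-trans : ∀ {a b c} → a ≼ b → b ≼ c → a ≼ c
  ≼-trans p q = record { cond-⊑ = ⊑-trans (cond-⊑ p) (cond-⊑ q)
                       ; side-≼ = λ e → ≼ˢ-trans (side-≼ p e) (side-≼ q e) }

  update : ∀ s e q′ → q′ ⊑ cond s → ∀ d′ → d′ ≼ˢ side s e → (∀ c → F.Valid e c q′ (stems d′ c)) →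
           ∃ λ s′ → s′ ≼ s × cond s′ ≡ q′ × side s′ e ≡ d′
  update s e q′ q′⊑ d′ d′≼ v′ = s′ , s′≼s , refl , at-e em
    where
    new-side : ∀ {e′} → Dec (e′ ≡ e) → Side
    new-side (yes _) = d′
    new-side {e′} (no _) = side s e′
    new-valid : ∀ {e′} (dec : Dec (e′ ≡ e)) → ∀ c → F.Valid e′ c q′ (stems (new-side dec) c)
    new-valid (yes refl) c = v′ c
    new-valid {e′} (no _) c = F.Valid-⊑ e′ {s = stems (side s e′) c} q′⊑ (valid s e′ c)
    new-≼ : ∀ {e′} (dec : Dec (e′ ≡ e)) → new-side dec ≼ˢ side s e′
    new-≼ (yes refl) = d′≼
    new-≼ (no _) = ≼ˢ-refl
    at-e : (dec : Dec (e ≡ e)) → new-side dec ≡ d′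
    at-e (yes _) = refl
    at-e (no e≢e) = ⊥-elim (e≢e refl)
    s′ : State
    s′ = record { cond = q′ ; side = λ e′ → new-side (em {e′ ≡ e}) ; valid = λ e′ → new-valid em }
    s′≼s : s′ ≼ s
    s′≼s = record { cond-⊑ = q′⊑ ; side-≼ = λ e′ → new-≼ em }

  Divergent : PR 1 → Condition → Set
  Divergent e q = ∃ λ d → ∃ λ u → ∀ f → f extends q → ¬ ∃ (Computed e f d u)

  -- Below such a condition a requirement `(d , N , c)` can only be met by forcing the colour
  -- `not c` beyond `N`, so a generic coloring computes one that is unstable at `d`.
  Unlockable : PR 1 → Condition → Set
  Unlockable e q = ∃ λ d → ∀ q′ → q′ ⊑ q → ∀ N c → ¬ F.Locks e q′ d N c

  -- The three kinds are: a pair of goals, one for each colour; the decision whether a number is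
  -- locked to a given colour from `N` on; the growth of the rows and of R.
  Requirement : Set
  Requirement = PR 1 × ((Goal × Goal) ⊎ ((ℕ × (ℕ × Bool)) ⊎ ℕ))

  AchievedBy : PR 1 → Condition → Side → Bool → Goal → Set
  AchievedBy e q d c g = M.Achieved e g q (stems d c) (reservoir d)

  pick : {A : Set} → A → A → Bool → A
  pick a b true = a
  pick a b false = b

  Met : PR 1 → (Goal × Goal) ⊎ ((ℕ × (ℕ × Bool)) ⊎ ℕ) → Condition → Side → Set
  Met e (inj₁ (g₁ , g₂)) q d =
    (Divergent e q ⊎ Unlockable e q) ⊎ ∃ λ c → AchievedBy e q d c (pick g₁ g₂ c)
  Met e (inj₂ (inj₁ (x , N , c))) q d =
    F.Locks e q x N c ⊎ ∃ λ v → N ≤ v × (∀ f → f extends q → Computed e f x v (not c))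
  Met e (inj₂ (inj₂ b)) q d =
    b ≤ rows q × (∀ c → ∃ λ r → b ≤ r × r < bound (stems d c) × members (stems d c) true r ≡ true)

  Meets : Requirement → State → Set
  Meets (e , r) s = Met e r (cond s) (side s e)

  update-met : ∀ {s e q′ d′} r → q′ ⊑ cond s → d′ ≼ˢ side s e →
               (∀ c → F.Valid e c q′ (stems d′ c)) → Met e r q′ d′ →
               ∃ λ s′ → s′ ≼ s × Meets (e , r) s′
  update-met {s} {e} {q′} {d′} r q′⊑ d′≼ v′ met with update s e q′ q′⊑ d′ d′≼ v′
  ... | s′ , s′≼ , refl , refl = s′ , s′≼ , met

  update-cond : ∀ {s e q′} r → q′ ⊑ cond s → Met e r q′ (side s e) →
                ∃ λ s′ → s′ ≼ s × Meets (e , r) s′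
  update-cond {s} {e} r q′⊑ met = update-met r q′⊑ ≼ˢ-refl
    (λ c → F.Valid-⊑ e {s = stems (side s e) c} q′⊑ (valid s e c)) met

  good : ∀ e q → ¬ (∃ λ q′ → q′ ⊑ q × (Divergent e q′ ⊎ Unlockable e q′)) → F.Good e q
  good e q never = record
    { total = λ q′ q′⊑ d u → dne λ none → never (q′ , q′⊑ , inj₁ (d , u , λ f fe φ →
        none (f , fe , φ)))
    ; stable = λ q′ q′⊑ d → dne λ none → never (q′ , q′⊑ , inj₂ (d , λ q″ q″⊑ N c l →
        none (q″ , q″⊑ , N , c , l)))
    }

  meet : ∀ r s → ∃ λ s′ → s′ ≼ s × Meets r s′
  meet (e , r@(inj₁ (g₁ , g₂))) s = by-cases em
    where
    d = side s e
    by-cases : Dec (∃ λ q′ → q′ ⊑ cond s × (Divergent e q′ ⊎ Unlockable e q′)) →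
               ∃ λ s′ → s′ ≼ s × Meets (e , r) s′
    by-cases (yes (q′ , q′⊑ , div)) = update-cond r q′⊑ (inj₁ div)
    by-cases (no never) = from-reach
        (M.goal-reachable e (good e (cond s) never) (infinite d) (stems d) (pick g₁ g₂) (valid s e))
      where
      from-reach : (∃ λ c → M.Reachable e c (cond s) (reservoir d) (stems d c) (pick g₁ g₂ c)) →
                   ∃ λ s′ → s′ ≼ s × Meets (e , r) s′
      from-reach (true , M.reach {A′ = A′} {s′} q′⊑ A′⊆ inf ex v a) = update-met {d′ = d′} r q′⊑
        (record { thinner = A′⊆ ; prolongs = λ { true → ex ; false → Ext-refl } })
        (λ { true → v ; false → F.Valid-⊑ e {s = stems d false} q′⊑ (valid s e false) })
        (inj₂ (true , a))
        where
        d′ : Side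
        d′ = record { stems = pick s′ (stems d false) ; reservoir = A′ ; infinite = inf }
      from-reach (false , M.reach {A′ = A′} {s′} q′⊑ A′⊆ inf ex v a) = update-met {d′ = d′} r q′⊑
        (record { thinner = A′⊆ ; prolongs = λ { true → Ext-refl ; false → ex } })
        (λ { true → F.Valid-⊑ e {s = stems d true} q′⊑ (valid s e true) ; false → v })
        (inj₂ (false , a))
        where
        d′ : Side
        d′ = record { stems = pick (stems d true) s′ ; reservoir = A′ ; infinite = inf }
  meet (e , r@(inj₂ (inj₁ (x , N , c)))) s = by-cases em
    where
    by-cases : Dec (∃ λ f → f extends cond s × ∃ λ v → N ≤ v × Computed e f x v (not c)) →
               ∃ λ s′ → s′ ≼ s × Meets (e , r) s′
    by-cases (yes (f , fe , v , N≤v , φ)) =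
      let (q′ , q′⊑ , h) = F.force e fe φ in update-cond r q′⊑ (inj₂ (v , N≤v , h))
    by-cases (no none) = update-cond r ⊑-refl (inj₁ λ f fe v N≤v φ → none (f , fe , v , N≤v , φ))
  -- Only R grows here, which keeps validity for every program, even one whose coloring is partial
  -- or unstable.
  meet (e , r@(inj₂ (inj₂ b))) s = update-met {d′ = d′} r q′⊑
      (record { thinner = λ _ _ a → a ; prolongs = λ c → ROnly.extension (grown c) })
      (λ c → F.Valid-⊑ e {s = s′ c} q′⊑ (M.ROnly-valid e {c} {cond s} {s = stems d c} {s′ c} (valid s e c) (grown c)))
      (m≤n⊔m (rows (cond s)) b , λ c → fresh c , fresh≥b c , n<1+n (fresh c) , put-hit _ true (fresh c) true)
    where
    d = side s e
    q′⊑ : truncate (cond s) (coloring (cond s)) b ⊑ cond s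
    q′⊑ = truncate-⊑ (cond s) (coloring (cond s)) b
    fresh : Bool → ℕ
    fresh c = proj₁ (infinite d true (b ⊔ bound (stems d c)))
    fresh≥b : ∀ c → b ≤ fresh c
    fresh≥b c = ≤-trans (m≤m⊔n b _) (proj₁ (proj₂ (infinite d true (b ⊔ bound (stems d c)))))
    fresh≥bound : ∀ c → bound (stems d c) ≤ fresh c
    fresh≥bound c = ≤-trans (m≤n⊔m b _) (proj₁ (proj₂ (infinite d true (b ⊔ bound (stems d c)))))
    s′ : Bool → Stem
    s′ c = stem (put (restrict (stems d c)) true (fresh c) true) (suc (fresh c))
    grown : ∀ c → ROnly (reservoir d) (stems d c) (s′ c)
    grown c = r-only
      (Ext-trans (restrict-Ext (stems d c) (bound (stems d c)) ≤-refl)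
        (put-Ext (restrict-empty (stems d c)) ≤-refl (fresh≥bound c)
          (proj₂ (proj₂ (infinite d true (b ⊔ bound (stems d c)))))))
      (λ x b≤x _ → trans (put-miss _ true (fresh c) true false x (inj₁ λ ()))
                         (restrict-empty (stems d c) false x b≤x))
    d′ : Side
    d′ = record { stems = s′ ; reservoir = reservoir d ; infinite = infinite d }

  -- The state at which a requirement is met is remembered, in place of a proof that `Meets`
  -- persists.
  Passes : Requirement → State → State → Set
  Passes r s s′ = ∃ λ s″ → s″ ≼ s × s′ ≼ s″ × Meets r s″

  meet-all : ∀ rs s → ∃ λ s′ → s′ ≼ s × (∀ r → r ∈ rs → Passes r s s′)
  meet-all [] s = s , ≼-refl , λ _ ()
  meet-all (r ∷ rs) s =
    let (s₁ , s₁≼ , met) = meet r s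
        (s₂ , s₂≼ , all) = meet-all rs s₁
    in s₂ , ≼-trans s₂≼ s₁≼ , λ
      { r′ (here refl) → s₁ , s₁≼ , s₂≼ , met
      ; r′ (there r′∈) → let (s₃ , a , b , c) = all r′ r′∈ in s₃ , ≼-trans a s₁≼ , b , c }

  requirements : Enumeration Requirement
  requirements = PR-enumeration ×-enumeration ((goals ×-enumeration goals) ⊎-enumeration
    ((ℕ-enumeration ×-enumeration (ℕ-enumeration ×-enumeration Bool-enumeration))
     ⊎-enumeration ℕ-enumeration))
    where
    goals : Enumeration Goal
    goals = ℕ-enumeration ⊎-enumeration PR-enumeration

  initial : State
  initial = record
    { cond = record { rows = 0 ; coloring = λ _ _ → false ; convergent = λ _ → false , 0 , λ _ _ → refl }
    ; side = λ _ → record { stems = λ _ → stem (λ _ _ → false) 0 ; reservoir = λ _ _ → true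
                          ; infinite = λ _ n → n , ≤-refl , refl }
    ; valid = λ _ _ _ _ ()
    }

  record Round (ns : ℕ × State) (ns′ : ℕ × State) : Set where
    field
      counts : proj₁ ns′ ≡ suc (proj₁ ns)
      descends : proj₂ ns′ ≼ proj₂ ns
      passes : ∀ r → r ∈ level requirements (proj₁ ns) → Passes r (proj₂ ns) (proj₂ ns′)
  open Round

  round : ∀ ns → ∃ (Round ns)
  round (n , s) = let (s′ , s′≼ , all) = meet-all (level requirements n) s in
    (suc n , s′) , record { counts = refl ; descends = s′≼ ; passes = all }

  abstract
    run : ℕ → ℕ × State
    run = iterate {R = Round} round (0 , initial)

    run-round : ∀ n → Round (run n) (run (suc n))
    run-round = iterate-step {R = Round} round (0 , initial)

    run-count : ∀ n → proj₁ (run n) ≡ n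
    run-count zero = refl
    run-count (suc n) = trans (counts (run-round n)) (cong suc (run-count n))

  state : ℕ → State
  state n = proj₂ (run n)

  state-≼ : ∀ {m n} → m ≤ n → state n ≼ state m
  state-≼ = transitive-chain {_≼_ = _≼_} ≼-refl (λ p q → ≼-trans p q) state
    (λ n → descends (run-round n))

  OnPath : State → Set
  OnPath s = ∃ λ m → state m ≼ s

  met : ∀ r → ∃ λ s → OnPath s × Meets r s
  met r = let
      (n , r∈) = covers requirements r
      (s , _ , s≽ , h) = passes (run-round n) r
        (subst (λ k → r ∈ level requirements k) (sym (run-count n)) r∈)
    in s , (suc n , s≽) , h

  large : ∀ e b → ∃ λ m → b ≤ rows (cond (state m)) × (∀ c → b < bound (stems (side (state m) e) c))
  large e b = let (s , (m , m≼) , b≤ , grown) = met (e , inj₂ (inj₂ b)) in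
    m , ≤-trans b≤ (more-rows (cond-⊑ m≼)) ,
    λ c → let (r , b≤r , r< , _) = grown c in
      ≤-<-trans b≤r (<-≤-trans r< (longer (prolongs (side-≼ m≼ e) c)))

  -- Any program could replace `zer`: the condition is common to all, and only the bound on its rows
  -- is taken from `large`.
  f : Coloring
  f x y = coloring (cond (state (proj₁ (large zer (suc x))))) x y

  f-extends-state : ∀ n → f extends cond (state n)
  f-extends-state n x x<n y with ≤-total (proj₁ (large zer (suc x))) n
  ... | inj₁ m≤n = sym (same-rows (cond-⊑ (state-≼ m≤n)) x (proj₁ (proj₂ (large zer (suc x)))) y)
  ... | inj₂ n≤m = same-rows (cond-⊑ (state-≼ n≤m)) x x<n y

  f-extends : ∀ {s} → OnPath s → f extends cond s
  f-extends (m , m≼) = extends-⊑ (cond-⊑ m≼) (f-extends-state m)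

  f-stable : Stable f
  f-stable x with convergent (cond (state (proj₁ (large zer (suc x))))) x
  ... | c , N , lim = c , N , λ u N<u _ → lim u (<⇒≤ N<u)

  approx : PR 1 → Bool → ℕ → Stem
  approx e c n = stems (side (state n) e) c

  limit : PR 1 → Bool → Reservoir
  limit e c τ x = members (approx e c (proj₁ (large e x))) τ x

  approx-Ext : ∀ e c {s m} → state m ≼ s → Ext (reservoir (side s e)) (stems (side s e) c) (approx e c m)
  approx-Ext e c m≼ = prolongs (side-≼ m≼ e) c

  limit-state : ∀ e c n τ x → x < bound (approx e c n) → limit e c τ x ≡ members (approx e c n) τ x
  limit-state e c n τ x x<b with ≤-total (proj₁ (large e x)) n
  ... | inj₁ m≤n = sym (same (approx-Ext e c (state-≼ m≤n)) τ x (proj₂ (proj₂ (large e x)) c))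
  ... | inj₂ n≤m = same (approx-Ext e c (state-≼ n≤m)) τ x x<b

  limit-path : ∀ e c {s} → OnPath s → ∀ τ x → x < bound (stems (side s e) c) →
               limit e c τ x ≡ members (stems (side s e) c) τ x
  limit-path e c (m , m≼) τ x x<b =
    trans (limit-state e c m τ x (<-≤-trans x<b (longer (approx-Ext e c m≼))))
          (same (approx-Ext e c m≼) τ x x<b)

  module Solve (fh : Coloring) (fh-stable : Stable fh) (e : PR 1)
               (computes : ∀ n → Eval (enc f) e (n ∷ []) (bit (enc fh n))) where

    value : ∀ {d u} → d < u → Computed e f d u (fh d u)
    value {d} {u} d<u = subst (λ b → Computed e f d u b) (enc-pair fh d<u) (computes (pair d u))

    -- For an unlockable `d`, consider the requirement for its true limit colour: a lock contradicts
    -- unlockability at a common later state, and a forced opposite value contradicts the limit.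
    ¬divergent : ∀ {s} → OnPath s → ¬ (Divergent e (cond s) ⊎ Unlockable e (cond s))
    ¬divergent path (inj₁ (d , u , none)) = none f (f-extends path) (_ , computes (pair d u))
    ¬divergent {s} (m , m≼) (inj₂ (d , none)) = from-met (met (e , inj₂ (inj₁ (d , N , c))))
      where
      c = proj₁ (fh-stable d)
      N₀ = proj₁ (proj₂ (fh-stable d))
      -- Beyond `d` as well as `N₀`, since `Stable` speaks only of pairs in increasing order.
      N = suc (N₀ ⊔ d)
      from-met : (∃ λ s′ → OnPath s′ × Meets (e , inj₂ (inj₁ (d , N , c))) s′) → ⊥
      from-met (s′ , path′@(m′ , m′≼) , inj₁ l) = none (cond (state (m ⊔ m′)))
        (cond-⊑ (≼-trans (state-≼ (m≤m⊔n m m′)) m≼)) N c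
        (F.Locks-mono e (cond-⊑ (≼-trans (state-≼ (m≤n⊔m m m′)) m′≼)) ≤-refl l)
      from-met (s′ , path′ , inj₂ (v , N≤v , h)) = not-fixed (trans
        (computed-det e {f} (h f (f-extends path′)) (value d<v))
        (proj₂ (proj₂ (fh-stable d)) v (≤-trans (s≤s (m≤m⊔n N₀ d)) N≤v) d<v))
        where
        d<v : d < v
        d<v = ≤-trans (s≤s (m≤n⊔m N₀ d)) N≤v

    Fulfilled : Bool → Goal → Set
    Fulfilled c g = ∃ λ s → OnPath s × AchievedBy e (cond s) (side s e) c g

    fulfilled : ∀ g₁ g₂ → Fulfilled true g₁ ⊎ Fulfilled false g₂
    fulfilled g₁ g₂ with met (e , inj₁ (g₁ , g₂))
    ... | s , path , inj₁ div = ⊥-elim (¬divergent path div)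
    ... | s , path , inj₂ (true , a) = inj₁ (s , path , a)
    ... | s , path , inj₂ (false , a) = inj₂ (s , path , a)

    -- If the colour `true` misses a goal `g₁`, then pairing `g₁` with each `g₂` forces `false` to
    -- fulfil `g₂`.
    colour : ∃ λ c → ∀ g → Fulfilled c g
    colour with em {∀ g → Fulfilled true g}
    ... | yes h = true , h
    ... | no ¬h with ¬∀⇒∃¬ ¬h
    ...   | g₁ , ¬g₁ = false , λ g₂ → other (fulfilled g₁ g₂)
      where
      other : ∀ {g₂} → Fulfilled true g₁ ⊎ Fulfilled false g₂ → Fulfilled false g₂
      other (inj₁ h) = ⊥-elim (¬g₁ h)
      other (inj₂ h) = h

    c : Bool
    c = proj₁ colour

    H : Reservoir
    H = limit e c

    L-infinite : Infinite (H false)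
    L-infinite n with proj₂ colour (inj₁ n)
    ... | s , path , x , n≤x , x<b , x∈ = x , n≤x , trans (limit-path e c path false x x<b) x∈

    R-infinite : Infinite (H true)
    R-infinite n with met (e , inj₂ (inj₂ n))
    ... | s , path , _ , grown with grown c
    ...   | r , n≤r , r<b , r∈ = r , n≤r , trans (limit-path e c path true r r<b) r∈

    homogeneous : IncPHom fh (H false) (H true)
    homogeneous = L-infinite , R-infinite , c , λ x y x<y x∈ y∈ →
      let (m , _ , big) = large e y
          s = approx e c m
          x<b = <-trans x<y (big c)
      in bool-unless λ fh≡ → valid (state m) e c x y x<b
           (trans (sym (limit-state e c m false x x<b)) x∈) x<y
           (inj₂ (trans (sym (limit-state e c m true y (big c))) y∈))
           f (f-extends-state m) (subst (Computed e f x y) fh≡ (value x<y))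

    computes-nothing : ∀ L′ R′ → PHom f L′ R′ → ¬ ((L′ ⊕ R′) ≤T (H false ⊕ H true))
    computes-nothing L′ R′ ph (i , ev) = refute (proj₂ colour (inj₂ i))
      where
      P : Reservoir
      P false = L′
      P true = R′

      answer : ∀ τ x → Eval (H false ⊕ H true) i (index τ x ∷ []) (bit (P τ x))
      answer τ x = subst (λ b → Eval (H false ⊕ H true) i (index τ x ∷ []) (bit b))
                     (join-index P τ x) (ev (index τ x))

      outputs : ∀ {s} → OnPath s → ∀ τ x → Out (evaluator i) (stems (side s e) c) τ x → P τ x ≡ true
      outputs path τ x o = bit-injective (Eval-deterministic (answer τ x)
        (o H (λ σ y y<b → limit-path e c path σ y y<b)))

      output-late : ∀ τ x → P τ x ≡ true → ∃ λ k → ∀ m → k ≤ bound (approx e c m) →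
                    Out (evaluator i) (approx e c m) τ x
      output-late τ x x∈ with use (subst (λ b → Eval _ i (index τ x ∷ []) (bit b)) x∈ (answer τ x))
      ... | k , h = k , λ m k≤b A agree → h (A false ⊕ A true)
        (join-agree k (λ y y<k → below m k≤b A agree false y y<k)
                      (λ y y<k → below m k≤b A agree true y y<k))
        where
        below : ∀ m → k ≤ bound (approx e c m) → ∀ A →
          (∀ σ y → y < bound (approx e c m) → A σ y ≡ members (approx e c m) σ y) →
          ∀ σ y → y < k → A σ y ≡ H σ y
        below m k≤b A agree σ y y<k =
          trans (agree σ y (<-≤-trans y<k k≤b)) (sym (limit-state e c m σ y (<-≤-trans y<k k≤b)))

      refute : Fulfilled c (inj₂ i) → ⊥
      refute (s , path , inj₂ bad) = bad f (f-extends path) P (λ τ x → outputs path τ x) ph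
      refute (s , (m , m≼) , inj₁ (b , dead)) =
        -- Taking `y` above `x` makes the two distinct; `n` is late enough for both uses and for
        -- extending the state where `dead` holds.
        let (x , b≤x , x∈) = proj₁ ph b
            (y , ≤y , y∈) = proj₁ (proj₂ ph) (b ⊔ suc x)
            (k , late-x) = output-late false x x∈
            (k′ , late-y) = output-late true y y∈
            (m′ , _ , big) = large e (k ⊔ k′)
            n = m ⊔ m′
            big′ = ≤-trans (<⇒≤ (big c)) (longer (approx-Ext e c (state-≼ (m≤n⊔m m m′))))
        in dead (approx e c n) (approx-Ext e c (≼-trans (state-≼ (m≤m⊔n m m′)) m≼))
             (x , y , (λ x≡y → <⇒≢ (≤-trans (m≤n⊔m b (suc x)) ≤y) x≡y) , b≤x ,
              ≤-trans (m≤m⊔n b (suc x)) ≤y ,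
              late-x n (≤-trans (m≤m⊔n k k′) big′) , late-y n (≤-trans (m≤n⊔m k k′) big′))

theorem1p9 : ExcludedMiddle 0ℓ →
    Σ Coloring λ f → Stable f ×
    ((fh : Coloring) → Stable fh → enc fh ≤T enc f →
    Σ Subset λ L → Σ Subset λ R → IncPHom fh L R ×
    ((L′ R′ : Subset) → PHom f L′ R′ → ¬ ((L′ ⊕ R′) ≤T (L ⊕ R))))
theorem1p9 em = f , f-stable , λ fh st (e , computes) →
  let open Solve fh st e computes in H false , H true , homogeneous , computes-nothing
  where open Construction em
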